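{- Let $L$ be a skew basic $(p,q)$-leaper with $p<q$, and let $\frac qp=[c_1\pm,c_2\pm,\ldots,c_k]$ be the representation of $\frac qp$ as an even continued fraction. For all $i=1,\ldots,k$ let \[\frac{l_i}{d_i}=[c_1\pm,2-,c_2\pm,2-,\ldots,c_i],\] where $\frac{l_i}{d_i}$ is irreducible, the sign following each $c_j$ ($j<i$) is the same as in the representation of $\frac qp$, and the sign following each inserted term $2$ is $-$. Then the length of each cycle of type $i$ of $L$ within a $(p+q)\times(p+q)$ chessboard is $4l_i$.
   Context: Leapers. A square is a unit square of the infinite chessboard. A $(p,q)$-leaper is a piece that moves from a square $a$ to any of $a+(\pm p,\pm q)$, $a+(\pm q,\pm p)$. The leaper graph of $L$ over a set of squares $B$ has the squares of $B$ as vertices, two being adjacent when a move of $L$ joins them; a cycle of $L$ within $B$ is a simple cycle in this graph, and its length is its number of squares. The leaper is basic if $p+q$ is odd and $\gcd(p,q)=1$, and skew if $p,q$ are nonzero and distinct. Even continued fractions. $[c_1\pm,c_2\pm,\ldots,c_k]=c_1\pm\cfrac1{c_2\pm\cfrac1{\ddots\pm\frac1{c_k}}}$, where each sign is chosen independently, all $c_i$ are even integers, $c_1\ge0$ and $c_2,\ldots,c_k>0$. A nonnegative irreducible fraction $\frac qp$ with $p+q$ odd has exactly one such representation. Frames. Let $m<n$ be coprime positive integers with $m+n$ odd. Identify squares with their centers, the centers being the points of $\mathbb Z^2$. The $(m,n)$-frame $F$ is the set of squares $(x,y)$ with $\frac{n-m}2<\max(|x|,|y|)<\frac{m+n}2$,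 i.e. an $(m+n)\times(m+n)$ board with an $(n-m)\times(n-m)$ central hole. Its section $F_{\mathtt E}$ consists of the squares with $\frac{n-m}2<x<\frac{m+n}2$, $|y|<\frac{n-m}2$; its section $F_{\mathtt{NE}}$ of those with $\frac{n-m}2<x,y<\frac{m+n}2$; the sections $F_{\mathtt N},F_{\mathtt{NW}},F_{\mathtt W},F_{\mathtt{SW}},F_{\mathtt S},F_{\mathtt{SE}}$ are obtained by counterclockwise rotations by multiples of $90^\circ$ about the origin. In the leaper graph of the $(m,n)$-leaper over the $(m+n)\times(m+n)$ board the squares of the hole are isolated and all squares of $F$ have degree two, so a cycle is determined by its vertex set. Lifting. The lifting transformations $\mathtt f,\mathtt g,\mathtt h$ take $S\subseteq F$ to the disjoint union of $(S+v_i)\cap H_i$ over the eight directions $i$, where $H$ is respectively the $(m,2m+n)$-, $(n,2n-m)$-, $(n,m+2n)$-frame, and for $\mathtt f$: $v_{\mathtt E}=(m+n,0)$, $v_{\mathtt{NE}}=(m,m)$; for $\mathtt g$: $v_{\mathtt E}=(n-m,0)$, $v_{\mathtt{NE}}=(n,n)$; for $\mathtt h$: $v_{\mathtt E}=(m+n,0)$, $v_{\mathtt{NE}}=(n,n)$; the other $v_i$ are obtained by $90^\circ$ rotations. Each maps the vertex set of a cycle of the $(m,n)$-leaper within $F$ to the vertex set of a cycle of the leaper with the proportions of $H$ within $H$; this defines the lift of a cycle. Shell. Let $n\le3m$. If $2m\ge n$, the shell of $F$ is the union of eight $(n-m)\times(n-m)$ subboards: the four corners of $F$ and the four adjacent by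 side to the central hole. If $2m\le n\le3m$, it is the union of eight $(3m-n)\times(3m-n)$ subboards: one in the middle of each outer side and four adjacent by corner to the central hole. (When $n=2m$ both give all of $F$.) The shell is a union of eight-square cycles of the $(m,n)$-leaper, called shell cycles. Types. Let $p<q$ and $\frac qp=[c_1\pm,\ldots,c_k]$, and set $x_i=\mathtt g$ if the sign following $c_i$ is $-$ and $x_i=\mathtt h$ if it is $+$ ($1\le i<k$). Let $\mathtt f^{a}$ denote a run of $a$ characters $\mathtt f$, and $e^{(i)}=\mathtt f^{c_1/2-1}x_1\mathtt f^{c_2/2-1}x_2\cdots x_{i-1}\mathtt f^{c_i/2-1}$. For $i<k$ let $F^{(i)}$ be the frame whose (coprime) proportions $(m,n)$ satisfy $\frac nm=[2\pm,c_{i+1}\pm,\ldots,c_k]$, the sign after $2$ being the one following $c_i$ and the other signs being as in $\frac qp$; let $F^{(k)}$ be the $(1,2)$-frame. A cycle of $L$ within the $(p+q)\times(p+q)$ board is of type $i$ if it is obtained from a shell cycle of $F^{(i)}$ by successively applying the lifting transformations given by the characters of $e^{(i)}$, from the last character to the first. Every cycle of $L$ within the $(p+q)\times(p+q)$ board is of exactly one type. -}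

module Defs where

open import Level using (0ℓ)
open import Data.Nat.Base using (ℕ; _+_; _*_; _∸_; _≤_; _<_; NonZero)
open import Data.Nat.DivMod using (_/_)
open import Data.Nat.Coprimality using (Coprime)
open import Data.Nat.Divisibility using (_∣_)
open import Data.Integer.Base as ℤ using (ℤ; +_; _⊖_; _◃_)
open import Data.Rational.Base as ℚ using (ℚ; 1/_)
open import Data.Sign.Base as Sign using (Sign)
open import Data.Fin.Base using (Fin; zero; suc)
open import Data.List.Base using (List; []; _∷_; _∷ʳ_; _++_; length; replicate; foldr; drop)
open import Data.List.Membership.Propositional using (_∈_)
open import Data.List.Relation.Unary.All using (All)
open import Data.List.Relation.Unary.Linked using (Linked)
open import Data.List.Relation.Unary.Unique.Propositional using (Unique)
open import Data.Product.Base using (Σ-syntax; ∃; ∃₂; ∃-syntax; _×_; _,_)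
open import Data.Sum.Base using (_⊎_)
open import Relation.Binary.PropositionalEquality.Core using (_≡_; _≢_)
open import Relation.Nullary.Negation.Core using (¬_)
open import Relation.Unary using (Pred; _≐_)

Square : Set
Square = ℤ × ℤ

SquareSet : Set₁
SquareSet = Pred Square 0ℓ

infixl 6 _+ᵥ_ _-ᵥ_

_+ᵥ_ _-ᵥ_ : Square → Square → Square
(x , y) +ᵥ (x′ , y′) = x ℤ.+ x′ , y ℤ.+ y′
(x , y) -ᵥ (x′ , y′) = x ℤ.- x′ , y ℤ.- y′

translate : Square → SquareSet → SquareSet
translate v A s = A (s -ᵥ v)

-- Counterclockwise by 90°.
rotate : Square → Square
rotate (x , y) = ℤ.- y , x

-- The image of a set under rotate, given as the preimage under its inverse.
rotateSet : SquareSet → SquareSet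
rotateSet A (x , y) = A (y , ℤ.- x)

-- Bounds are on doubled coordinates, since the bounds are half-integers.
Box : (x₀ x₁ y₀ y₁ : ℤ) → SquareSet
Box x₀ x₁ y₀ y₁ (x , y) =
  (x₀ ℤ.< + 2 ℤ.* x × + 2 ℤ.* x ℤ.< x₁) ×
  (y₀ ℤ.< + 2 ℤ.* y × + 2 ℤ.* y ℤ.< y₁)

-- For odd N, the N × N board centered at the origin.
Board : ℕ → SquareSet
Board N = Box (ℤ.- + N) (+ N) (ℤ.- + N) (+ N)

------------------------------------------------------------------------
-- Leapers and cycles

IsBasic : ℕ → ℕ → Set
IsBasic p q = ¬ (2 ∣ p + q) × Coprime p q

IsSkew : ℕ → ℕ → Set
IsSkew p q = p ≢ 0 × q ≢ 0 × p ≢ q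

Move : ℕ → ℕ → Square → Square → Set
Move p q a b = ∃₂ λ (σ τ : Sign) →
  b ≡ a +ᵥ (σ ◃ p , τ ◃ q) ⊎ b ≡ a +ᵥ (σ ◃ q , τ ◃ p)

close : List Square → List Square
close []       = []
close (s ∷ ss) = s ∷ ss ∷ʳ s

-- C lists the squares of the cycle in cyclic order, each once.
record IsCycle (p q : ℕ) (B : SquareSet) (C : List Square) : Set where
  field
    atLeast3 : 3 ≤ length C
    within   : All B C
    simple   : Unique C
    closed   : Linked (Move p q) (close C)

------------------------------------------------------------------------
-- Even continued fractions

infixr 5 _⟨_⟩_

data ContinuedFraction : Set where
  [_]   : ℕ → ContinuedFraction
  _⟨_⟩_ : ℕ → Sign → ContinuedFraction → ContinuedFraction

terms : ContinuedFraction → List ℕ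
terms [ c ]       = c ∷ []
terms (c ⟨ σ ⟩ t) = c ∷ terms t

IsEven : ContinuedFraction → Set
IsEven t = All (2 ∣_) (terms t) × All (0 <_) (drop 1 (terms t))

signedSum : ℚ → Sign → ℚ → ℚ
signedSum x Sign.+ y = x ℚ.+ y
signedSum x Sign.- y = x ℚ.- y

-- Value t v : evaluating t involves no division by zero and yields v.
-- When IsEven t, every proper tail of t evaluates to more than 1, so t has
-- exactly one value.
data Value : ContinuedFraction → ℚ → Set where
  [_]   : ∀ c → Value [ c ] (+ c ℚ./ 1)
  _⟨_⟩_ : ∀ c σ {t v} → Value t v → .{{_ : ℚ.NonZero v}} →
          Value (c ⟨ σ ⟩ t) (signedSum (+ c ℚ./ 1) σ (1/ v))

infix 4 _hasValue_/_

_hasValue_/_ : ContinuedFraction → ℕ → ℕ → Set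
t hasValue n / d = Σ[ d≢0 ∈ NonZero d ] Value t ((+ n ℚ./ d) {{d≢0}})

-- Indices into the terms are zero-based, here and in what follows.
-- [c₁±, 2-, c₂±, 2-, …, cᵢ]
interleave2 : (t : ContinuedFraction) → Fin (length (terms t)) → ContinuedFraction
interleave2 [ c ]       zero    = [ c ]
interleave2 (c ⟨ σ ⟩ t) zero    = [ c ]
interleave2 (c ⟨ σ ⟩ t) (suc i) = c ⟨ σ ⟩ 2 ⟨ Sign.- ⟩ interleave2 t i

------------------------------------------------------------------------
-- Frames and lifting

data Direction : Set where
  E NE N NW W SW S SE : Direction

-- Extends data for E and NE to all directions by the rotation r.
byRotation : ∀ {ℓ} {A : Set ℓ} → (A → A) → A → A → Direction → A
byRotation r e ne E  = e
byRotation r e ne NE = ne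
byRotation r e ne N  = r e
byRotation r e ne NW = r ne
byRotation r e ne W  = r (r e)
byRotation r e ne SW = r (r ne)
byRotation r e ne S  = r (r (r e))
byRotation r e ne SE = r (r (r ne))

section : ℕ → ℕ → Direction → SquareSet
section m n = byRotation rotateSet
  (Box (n ⊖ m) (+ (m + n)) (m ⊖ n) (n ⊖ m))
  (Box (n ⊖ m) (+ (m + n)) (n ⊖ m) (+ (m + n)))

data Lifting : Set where
  𝕗 𝕘 𝕙 : Lifting

-- The proportions of the frame H; ∸ does not truncate, as m < n.
target : Lifting → ℕ × ℕ → ℕ × ℕ
target 𝕗 (m , n) = m , 2 * m + n
target 𝕘 (m , n) = n , 2 * n ∸ m
target 𝕙 (m , n) = n , m + 2 * n

shift : Lifting → ℕ × ℕ → Direction → Square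
shift 𝕗 (m , n) = byRotation rotate (+ (m + n) , + 0) (+ m , + m)
shift 𝕘 (m , n) = byRotation rotate (n ⊖ m , + 0)     (+ n , + n)
shift 𝕙 (m , n) = byRotation rotate (+ (m + n) , + 0) (+ n , + n)

lift : Lifting → ℕ × ℕ → SquareSet → SquareSet
lift x mn A s = let (m′ , n′) = target x mn in
  ∃[ i ] translate (shift x mn i) A s × section m′ n′ i s

-- Applies the characters of a word from the last to the first.
liftWord : List Lifting → ℕ × ℕ → SquareSet → SquareSet
liftWord []       mn A = A
liftWord (x ∷ xs) mn A = lift x (foldr target mn xs) (liftWord xs mn A)

------------------------------------------------------------------------
-- Shells

-- Four corners of the frame, four subboards adjacent by side to the hole.
shell₁ : ℕ → ℕ → Direction → SquareSet
shell₁ m n = byRotation rotateSet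
  (Box (n ⊖ m) (+ 3 ℤ.* (n ⊖ m)) (m ⊖ n) (n ⊖ m))
  (Box (3 * m ⊖ n) (+ (m + n)) (3 * m ⊖ n) (+ (m + n)))

-- Four middles of outer sides, four subboards adjacent by corner to the hole.
shell₂ : ℕ → ℕ → Direction → SquareSet
shell₂ m n = byRotation rotateSet
  (Box (3 * n ⊖ 5 * m) (+ (m + n)) (n ⊖ 3 * m) (3 * m ⊖ n))
  (Box (n ⊖ m) (5 * m ⊖ n) (n ⊖ m) (5 * m ⊖ n))

Shell : ℕ → ℕ → SquareSet
Shell m n s =
  (n ≤ 2 * m × (∃[ i ] shell₁ m n i s)) ⊎
  (2 * m ≤ n × n ≤ 3 * m × (∃[ i ] shell₂ m n i s))

IsShellCycle : ℕ → ℕ → List Square → Set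
IsShellCycle m n C = IsCycle m n (Shell m n) C × length C ≡ 8

------------------------------------------------------------------------
-- Types of cycles

liftingOf : Sign → Lifting
liftingOf Sign.- = 𝕘
liftingOf Sign.+ = 𝕙

-- The word e⁽ⁱ⁾.
typeWord : (t : ContinuedFraction) → Fin (length (terms t)) → List Lifting
typeWord [ c ]       zero    = replicate (c / 2 ∸ 1) 𝕗
typeWord (c ⟨ σ ⟩ t) zero    = replicate (c / 2 ∸ 1) 𝕗
typeWord (c ⟨ σ ⟩ t) (suc i) = replicate (c / 2 ∸ 1) 𝕗 ++ liftingOf σ ∷ typeWord t i

-- m and n are the proportions of the frame F⁽ⁱ⁾.
BaseFrame : (t : ContinuedFraction) → Fin (length (terms t)) → ℕ → ℕ → Set
BaseFrame [ c ]       zero    m n = m ≡ 1 × n ≡ 2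
BaseFrame (c ⟨ σ ⟩ t) zero    m n = Coprime m n × (2 ⟨ σ ⟩ t) hasValue n / m
BaseFrame (c ⟨ σ ⟩ t) (suc i) m n = BaseFrame t i m n

OfType : (t : ContinuedFraction) → Fin (length (terms t)) → List Square → Set
OfType t i C = ∃₂ λ m n → ∃[ C₀ ]
  BaseFrame t i m n × IsShellCycle m n C₀ ×
  (_∈ C) ≐ liftWord (typeWord t i) (m , n) (_∈ C₀)

{-# OPTIONS --safe #-}
module Submission where

-- The squares of a set within a frame are counted section by section. Let s
-- be the number of its squares in the side sections E, N, W, S, and c the
-- number of its squares in the corner sections NE, NW, SW, SE.
--
-- Lifting acts linearly on (s , c). The four grid lines at ±(n-m)/2 and
-- ±(m+n)/2 cut the board of the (m,n)-frame into the eight sections and the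
-- hole. When a section of the target frame is translated back, each of its
-- boundary lines falls on one of these grid lines, so its part of the lifted
-- set is a union of sections of the old set, possibly over the empty hole.
-- Reading off which sections occur gives
--
--   f : (s , c) ↦ (s + 2c , c)
--   g : (s , c) ↦ (s , c + 2s)
--   h : (s , c) ↦ (3s + 2c , c + 2s).
--
-- The whole configuration has a fourfold symmetry, so only the directions E
-- and NE need the computation (PieceSize-byRotation, Counted-lift).
--
-- A shell cycle has (s , c) = (4 , 4), because moves between squares of the
-- shell alternate between sides and corners (Zone-alternates). Every corner
-- square of the shell satisfies m < 2|x| , 2|y| < 3m, so no coordinate can
-- change by ±m; a side square has one doubled coordinate below m and the
-- other below 2n - m in absolute value, which excludes a move from side to
-- side in the same way (shellCycle-counted).
--
-- Hence a cycle of type i has 4(s + c) squares, where (s , c) is obtained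
-- from (1 , 1) by the word of the type (weights). By induction on the
-- continued fraction, (s + c)/c is the value of the interleaved fraction: if
-- l′/d′ = (s′ + c′)/c′ for the tail, then 2 - d′/l′ = (c′ + 2s′)/(s′ + c′),
-- and adding the reciprocal of this, with its sign, to the first term gives
-- the pair that g or h and then a run of f produce (interleave2-Ratio). The
-- maps above preserve coprimality, so s + c is the numerator in lowest terms.
-- All of this needs a positive first term, which p < q ensures
-- (firstTerm-positive).

open import Defs
open import Data.Bool.Base using (Bool; true; false; not; if_then_else_)
open import Data.Empty using (⊥; ⊥-elim)
open import Data.Fin.Base using (Fin; zero; suc)
open import Data.Integer.Base as ℤ using (ℤ; +_; _⊖_; -_; _◃_)
import Data.Integer.Properties as ℤ
open import Data.Integer.Tactic.RingSolver renaming (solve-∀ to ℤ-solve-∀)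
open import Data.List.Base using (List; []; _∷_; _++_; length; map; filter; foldr; replicate)
import Data.List.Properties as List
open import Data.List.Membership.Propositional using (_∈_)
open import Data.List.Membership.Propositional.Properties using
  (∈-++⁺ˡ; ∈-++⁺ʳ; ∈-++⁻; ∈-map⁺; ∈-map⁻; ∈-filter⁺; ∈-filter⁻)
open import Data.List.Membership.Propositional.Properties.WithK using (unique∧set⇒bag)
open import Data.List.Relation.Binary.BagAndSetEquality using (∼bag⇒↭)
open import Data.List.Relation.Binary.Permutation.Propositional.Properties using (↭-length)
open import Data.List.Relation.Unary.All as All using (All; []; _∷_)
open import Data.List.Relation.Unary.AllPairs using ([]; _∷_)
open import Data.List.Relation.Unary.Any using (here; there)
open import Data.List.Relation.Unary.Linked using (_∷_)
open import Data.List.Relation.Unary.Unique.DecPropositional using (unique?)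
open import Data.List.Relation.Unary.Unique.Propositional using (Unique)
import Data.List.Relation.Unary.Unique.Propositional.Properties as Unique
open import Data.Nat.Base as ℕ using
  (ℕ; zero; suc; z≤n; s≤s; _≤_; _<_; _+_; _*_; _∸_)
open import Data.Nat.Coprimality as Coprimality using (Coprime; coprime-divisor)
open import Data.Nat.Divisibility using (_∣_; divides; ∣m+n∣m⇒∣n; ∣n⇒∣m*n; ∣-antisym)
open import Data.Nat.DivMod using (_/_; m*n/n≡m)
open import Data.Nat.ListAction using (sum)
import Data.Nat.Properties as ℕ
open import Data.Nat.Tactic.RingSolver renaming (solve-∀ to ℕ-solve-∀)
open import Data.Product.Base using (∃-syntax; _×_; _,_; proj₁; proj₂)
open import Data.Rational.Base as ℚ using (ℚ; 1/_; toℚᵘ)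
import Data.Rational.Properties as ℚ
open import Data.Rational.Unnormalised.Base as ℚᵘ using (mkℚᵘ; *≡*)
import Data.Rational.Unnormalised.Properties as ℚᵘ
open import Data.Sign.Base as Sign using (Sign)
open import Data.Sum.Base using (_⊎_; inj₁; inj₂; [_,_]′)
open import Function.Base using (_∘_; id)
open import Function.Bundles using (mk⇔)
open import Relation.Binary.PropositionalEquality
open import Relation.Nullary using (¬_; Dec; yes; no; does)
open import Relation.Nullary.Decidable using (_×-dec_; from-yes)
open import Relation.Unary using (_≐_; _⊆_; _∩_; _∪_)

------------------------------------------------------------------------
-- Finite sets of squares

-- A has exactly k elements: it is enumerated without repetition by a list of
-- length k.
HasSize : SquareSet → ℕ → Set
HasSize A k = ∃[ xs ] Unique xs × length xs ≡ k × A ≐ (_∈ xs)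

size-cong : ∀ {A B k} → A ≐ B → HasSize A k → HasSize B k
size-cong (f , g) (xs , u , l , p , q) = xs , u , l , p ∘ g , f ∘ q

size-unique : ∀ {A k xs} → HasSize A k → Unique xs → (_∈ xs) ≐ A → length xs ≡ k
size-unique (ys , u , refl , p , q) v (f , g) =
  ↭-length (∼bag⇒↭ (unique∧set⇒bag v u (mk⇔ (p ∘ f) (g ∘ q))))

size-∅ : ∀ {A} → (∀ {s} → ¬ A s) → HasSize A 0
size-∅ ∅ = [] , [] , refl , (λ a → ⊥-elim (∅ a)) , λ ()

size-∪ : ∀ {A B k l} → (∀ {s} → A s → B s → ⊥) →
         HasSize A k → HasSize B l → HasSize (A ∪ B) (k + l)
size-∪ A∩B=∅ (xs , u , refl , p , q) (ys , v , refl , p′ , q′) =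
  xs ++ ys ,
  Unique.++⁺ u v (λ (x , y) → A∩B=∅ (q x) (q′ y)) ,
  List.length-++ xs ,
  [ ∈-++⁺ˡ ∘ p , ∈-++⁺ʳ xs ∘ p′ ]′ ,
  λ x → [ inj₁ ∘ q , inj₂ ∘ q′ ]′ (∈-++⁻ xs x)

-- For a bijection ψ with inverse φ.
size-preimage : ∀ {A k} (φ ψ : Square → Square) →
                (∀ s → φ (ψ s) ≡ s) → (∀ s → ψ (φ s) ≡ s) →
                HasSize A k → HasSize (A ∘ ψ) k
size-preimage {A} φ ψ φψ ψφ (xs , u , refl , p , q) =
  map φ xs ,
  Unique.map⁺ (λ {x} {y} e → trans (sym (ψφ x)) (trans (cong ψ e) (ψφ y))) u ,
  List.length-map φ xs ,
  (λ {s} a → subst (_∈ map φ xs) (φψ s) (∈-map⁺ φ (p a))) ,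
  λ m → let (x , x∈xs , e) = ∈-map⁻ φ m in
    subst A (sym (trans (cong ψ e) (ψφ x))) (q x∈xs)

rotate⁻¹ : Square → Square
rotate⁻¹ (x , y) = y , - x

rotate-rotate⁻¹ : ∀ s → rotate (rotate⁻¹ s) ≡ s
rotate-rotate⁻¹ (x , y) = cong (_, y) (ℤ.neg-involutive x)

rotate⁻¹-rotate : ∀ s → rotate⁻¹ (rotate s) ≡ s
rotate⁻¹-rotate (x , y) = cong (x ,_) (ℤ.neg-involutive y)

size-rotate : ∀ {A k} → HasSize A k → HasSize (A ∘ rotate) k
size-rotate = size-preimage rotate⁻¹ rotate rotate⁻¹-rotate rotate-rotate⁻¹

size-rotateSet : ∀ {A k} → HasSize A k → HasSize (rotateSet A) k
size-rotateSet = size-preimage rotate rotate⁻¹ rotate-rotate⁻¹ rotate⁻¹-rotate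

size-translate : ∀ {A k} v → HasSize A k → HasSize (translate v A) k
size-translate (a , b) = size-preimage (_+ᵥ (a , b)) (_-ᵥ (a , b))
  (λ (x , y) → cong₂ _,_ (i-j+j x a) (i-j+j y b))
  (λ (x , y) → cong₂ _,_ (i+j-j x a) (i+j-j y b))
  where
  i-j+j : ∀ i j → i ℤ.- j ℤ.+ j ≡ i
  i-j+j = ℤ-solve-∀
  i+j-j : ∀ i j → i ℤ.+ j ℤ.- j ≡ i
  i+j-j = ℤ-solve-∀

------------------------------------------------------------------------
-- Intervals with half-integer ends

-- An inequality transfers along an equality of differences.
≤-by : ∀ {a b c d} → a ℤ.≤ b → a ℤ.- b ≡ c ℤ.- d → c ℤ.≤ d
≤-by a≤b e = ℤ.i-j≤0⇒i≤j (subst (ℤ._≤ + 0) e (ℤ.i≤j⇒i-j≤0 a≤b))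

<-by : ∀ {a b c d} → a ℤ.< b → a ℤ.- b ≡ c ℤ.- d → c ℤ.< d
<-by {a} {b} {c} {d} a<b e = ℤ.suc[i]≤j⇒i<j (≤-by (ℤ.i<j⇒suc[i]≤j a<b)
  (trans (ℤ.+-assoc (+ 1) a (- b)) (trans (cong (λ i → + 1 ℤ.+ i) e) (sym (ℤ.+-assoc (+ 1) c (- d))))))

-- The constraint that a Box puts on one coordinate; as there, the bounds are on
-- the doubled coordinate.
Segment : ℤ → ℤ → ℤ → Set
Segment a b z = a ℤ.< + 2 ℤ.* z × + 2 ℤ.* z ℤ.< b

Segment-⊆ : ∀ {a b c d} → c ℤ.≤ a → b ℤ.≤ d → Segment a b ⊆ Segment c d
Segment-⊆ c≤a b≤d (a<z , z<b) = ℤ.≤-<-trans c≤a a<z , ℤ.<-≤-trans z<b b≤d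

Segment-shift : ∀ {a b c d} u → c ≡ a ℤ.+ + 2 ℤ.* u → d ≡ b ℤ.+ + 2 ℤ.* u → ∀ z →
  (Segment c d z → Segment a b (z ℤ.- u)) × (Segment a b (z ℤ.- u) → Segment c d z)
Segment-shift {a} {b} u refl refl z =
  (λ (c<z , z<d) → <-by c<z (lo a u z) , <-by z<d (hi b u z)) ,
  (λ (a<z , z<b) → <-by a<z (sym (lo a u z)) , <-by z<b (sym (hi b u z)))
  where
  lo : ∀ a u z → a ℤ.+ + 2 ℤ.* u ℤ.- + 2 ℤ.* z ≡ a ℤ.- + 2 ℤ.* (z ℤ.- u)
  lo = ℤ-solve-∀
  hi : ∀ b u z → + 2 ℤ.* z ℤ.- (b ℤ.+ + 2 ℤ.* u) ≡ + 2 ℤ.* (z ℤ.- u) ℤ.- b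
  hi = ℤ-solve-∀

Segment-neg : ∀ {a b c d} → c ≡ - b → d ≡ - a → ∀ {z} → Segment a b (- z) → Segment c d z
Segment-neg {a} {b} refl refl {z} (a<-z , -z<b) = <-by -z<b (hi b z) , <-by a<-z (lo a z)
  where
  lo : ∀ a z → a ℤ.- + 2 ℤ.* - z ≡ + 2 ℤ.* z ℤ.- (- a)
  lo = ℤ-solve-∀
  hi : ∀ b z → + 2 ℤ.* - z ℤ.- b ≡ - b ℤ.- + 2 ℤ.* z
  hi = ℤ-solve-∀

Segment-+ : ∀ {a b c d z w} → Segment a b z → Segment c d w → Segment (a ℤ.+ c) (b ℤ.+ d) (z ℤ.+ w)
Segment-+ {z = z} {w} (p , q) (p′ , q′) =
  subst (_ ℤ.<_) (sym (ℤ.*-distribˡ-+ (+ 2) z w)) (ℤ.+-mono-< p p′) ,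
  subst (ℤ._< _) (sym (ℤ.*-distribˡ-+ (+ 2) z w)) (ℤ.+-mono-< q q′)

Segment-cong : ∀ {a b z a′ b′ z′} → a ≡ a′ → b ≡ b′ → z ≡ z′ → Segment a b z → Segment a′ b′ z′
Segment-cong refl refl refl p = p

Segment-sym : ∀ {a b z} → Segment a b z → Segment (- b) (- a) (- z)
Segment-sym {a} {b} {z} p = Segment-neg refl refl (subst (Segment a b) (sym (ℤ.neg-involutive z)) p)

------------------------------------------------------------------------
-- The grid of a frame

-- Twice the coordinates of the four grid lines of the (m,n)-frame, which increase
-- if m ≤ n; indices above 3 repeat the last line.
line : ℕ → ℕ → ℕ → ℤ
line m n 0 = - + (m + n)
line m n 1 = m ⊖ n
line m n 2 = n ⊖ m
line m n _ = + (m + n)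

-- The strip between two consecutive grid lines; only k = 0, 1, 2 matter.
Band : ℕ → ℕ → ℕ → ℤ → Set
Band m n k = Segment (line m n k) (line m n (suc k))

module _ {m n : ℕ} (m≤n : m ≤ n) where

  line-step : ∀ k → line m n k ℤ.≤ line m n (suc k)
  line-step 0 = subst₂ ℤ._≤_ (ℤ.⊖-swap 0 (m + n)) refl
    (ℤ.≤-trans (ℤ.⊖-monoʳ-≥-≤ 0 (ℕ.m≤n+m n m)) (ℤ.⊖-monoˡ-≤ n z≤n))
  line-step 1 = ℤ.≤-trans (ℤ.⊖-monoˡ-≤ n m≤n) (ℤ.⊖-monoʳ-≥-≤ n m≤n)
  line-step 2 = ℤ.≤-trans (ℤ.m⊖n≤m n m) (ℤ.+≤+ (ℕ.m≤n+m n m))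
  line-step (suc (suc (suc _))) = ℤ.≤-refl

  line-mono : ∀ {i j} → i ≤ j → line m n i ℤ.≤ line m n j
  line-mono i≤j = go (ℕ.≤⇒≤′ i≤j)
    where
    go : ∀ {i j} → i ℕ.≤′ j → line m n i ℤ.≤ line m n j
    go (ℕ.≤′-reflexive refl) = ℤ.≤-refl
    go (ℕ.≤′-step {j} p) = ℤ.≤-trans (go p) (line-step j)

  line-cancel-< : ∀ {i j} → line m n i ℤ.< line m n j → i < j
  line-cancel-< lt = ℕ.≰⇒> (λ j≤i → ℤ.<⇒≱ lt (line-mono j≤i))

  Band⇒Segment : ∀ {i j k z} → i ≤ k × k < j → Band m n k z → Segment (line m n i) (line m n j) z
  Band⇒Segment (i≤k , k<j) = Segment-⊆ (line-mono i≤k) (line-mono k<j)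

  -- The grid lines may coincide, but a band that contains a point is not degenerate;
  -- this forces the inequalities between the indices.
  Band∩Segment : ∀ {i j k z} → Band m n k z → Segment (line m n i) (line m n j) z → i ≤ k × k < j
  Band∩Segment (a<z , z<b) (c<z , z<d) =
    ℕ.≤-pred (line-cancel-< (ℤ.<-trans c<z z<b)) , line-cancel-< (ℤ.<-trans a<z z<d)

  Band-unique : ∀ {j k z} → Band m n j z → Band m n k z → j ≡ k
  Band-unique b b′ = let (k≤j , j<k+1) = Band∩Segment b b′ in ℕ.≤-antisym (ℕ.≤-pred j<k+1) k≤j

Band-neg : ∀ {m n k z} → k ≤ 2 → Band m n k (- z) → Band m n (2 ∸ k) z
Band-neg {m} {n} {0} _ = Segment-neg (ℤ.⊖-swap n m) (sym (ℤ.neg-involutive _))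
Band-neg {m} {n} {1} _ = Segment-neg (ℤ.⊖-swap m n) (ℤ.⊖-swap n m)
Band-neg {m} {n} {2} _ = Segment-neg refl (ℤ.⊖-swap m n)
Band-neg {k = suc (suc (suc _))} (s≤s (s≤s ()))

------------------------------------------------------------------------
-- The eight sections as cells of the grid

-- Counterclockwise rotation by 90°.
next : Direction → Direction
next E = N
next NE = NW
next N = W
next NW = SW
next W = S
next SW = SE
next S = E
next SE = NE

-- The bands of the two coordinates of a section.
col row : Direction → ℕ
col E  = 2
col NE = 2
col N  = 1
col NW = 0
col W  = 0
col SW = 0
col S  = 1
col SE = 2
row E  = 1
row NE = 2
row N  = 2
row NW = 2
row W  = 1
row SW = 0
row S  = 0
row SE = 0

-- The left inverse of (col , row); the central hole gets a dummy value.
direction : ℕ → ℕ → Direction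
direction 0 0 = SW
direction 0 1 = W
direction 0 _ = NW
direction 1 0 = S
direction 1 _ = N
direction _ 0 = SE
direction _ 1 = E
direction _ _ = NE

direction-col-row : ∀ d → direction (col d) (row d) ≡ d
direction-col-row E = refl
direction-col-row NE = refl
direction-col-row N = refl
direction-col-row NW = refl
direction-col-row W = refl
direction-col-row SW = refl
direction-col-row S = refl
direction-col-row SE = refl

colrow-injective : ∀ {d e} → col d ≡ col e → row d ≡ row e → d ≡ e
colrow-injective {d} {e} p q =
  trans (sym (direction-col-row d)) (trans (cong₂ direction p q) (direction-col-row e))

_≟_ : (d e : Direction) → Dec (d ≡ e)
d ≟ e with col d ℕ.≟ col e | row d ℕ.≟ row e
... | yes p | yes q = yes (colrow-injective p q)
... | no p | _ = no (λ e → p (cong col e))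
... | yes _ | no q = no (λ e → q (cong row e))

next⁴ : ∀ d → next (next (next (next d))) ≡ d
next⁴ E = refl
next⁴ NE = refl
next⁴ N = refl
next⁴ NW = refl
next⁴ W = refl
next⁴ SW = refl
next⁴ S = refl
next⁴ SE = refl

row≤2 : ∀ d → row d ≤ 2
row≤2 E = s≤s z≤n
row≤2 NE = ℕ.≤-refl
row≤2 N = ℕ.≤-refl
row≤2 NW = ℕ.≤-refl
row≤2 W = s≤s z≤n
row≤2 SW = z≤n
row≤2 S = z≤n
row≤2 SE = z≤n

next-col-row : ∀ d → col (next d) ≡ 2 ∸ row d × row (next d) ≡ col d
next-col-row E = refl , refl
next-col-row NE = refl , refl
next-col-row N = refl , refl
next-col-row NW = refl , refl
next-col-row W = refl , refl
next-col-row SW = refl , refl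
next-col-row S = refl , refl
next-col-row SE = refl , refl

-- If Q is invariant under rotation, an inclusion of the sets of eight directions
-- in Q follows from its cases E and NE.
byRotation-⊆ : ∀ {A B : SquareSet} (Q : Direction → SquareSet) →
  (∀ d {s} → Q d (rotate⁻¹ s) → Q (next d) s) →
  A ⊆ Q E → B ⊆ Q NE → ∀ d → byRotation rotateSet A B d ⊆ Q d
byRotation-⊆ Q r a b E = a
byRotation-⊆ Q r a b NE = b
byRotation-⊆ Q r a b N = r E ∘ a
byRotation-⊆ Q r a b NW = r NE ∘ b
byRotation-⊆ Q r a b W = r N ∘ r E ∘ a
byRotation-⊆ Q r a b SW = r NW ∘ r NE ∘ b
byRotation-⊆ Q r a b S = r W ∘ r N ∘ r E ∘ a
byRotation-⊆ Q r a b SE = r SW ∘ r NW ∘ r NE ∘ b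

-- The converse inclusion likewise.
byRotation-⊇ : ∀ {A B : SquareSet} (Q : Direction → SquareSet) →
  (∀ d {s} → Q (next d) s → Q d (rotate⁻¹ s)) →
  Q E ⊆ A → Q NE ⊆ B → ∀ d → Q d ⊆ byRotation rotateSet A B d
byRotation-⊇ Q r a b E = a
byRotation-⊇ Q r a b NE = b
byRotation-⊇ Q r a b N = a ∘ r E
byRotation-⊇ Q r a b NW = b ∘ r NE
byRotation-⊇ Q r a b W = a ∘ r E ∘ r N
byRotation-⊇ Q r a b SW = b ∘ r NE ∘ r NW
byRotation-⊇ Q r a b S = a ∘ r E ∘ r N ∘ r W
byRotation-⊇ Q r a b SE = b ∘ r NE ∘ r NW ∘ r SW

-- The section in direction d, described symmetrically in all directions.
Cell : ℕ → ℕ → Direction → SquareSet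
Cell m n d (x , y) = Band m n (col d) x × Band m n (row d) y

Cell-next : ∀ {m n} d {s} → Cell m n d (rotate⁻¹ s) → Cell m n (next d) s
Cell-next {m} {n} d (p , q) = let (e , f) = next-col-row d in
  subst₂ (λ c r → Band m n c _ × Band m n r _) (sym e) (sym f) (Band-neg {m} {n} (row≤2 d) q , p)

section⇒Cell : ∀ {m n} d → section m n d ⊆ Cell m n d
section⇒Cell {m} {n} = byRotation-⊆ (Cell m n) (Cell-next {m} {n}) id id

Cell-prev : ∀ {m n} d {s} → Cell m n (next d) s → Cell m n d (rotate⁻¹ s)
Cell-prev {m} {n} d {x , y} (p , q) = let (e , f) = next-col-row d in
  subst (λ k → Band m n k y) f q ,
  subst (λ k → Band m n k (- x)) (trans (cong (2 ∸_) e) (ℕ.m∸[m∸n]≡n (row≤2 d)))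
    (Band-neg {m} {n} (subst (_≤ 2) (sym e) (ℕ.m∸n≤m 2 (row d))) (subst (Band m n (col (next d))) (sym (ℤ.neg-involutive x)) p))

Cell⇒section : ∀ {m n} d → Cell m n d ⊆ section m n d
Cell⇒section {m} {n} = byRotation-⊇ (Cell m n) (Cell-prev {m} {n}) id id

section-unique : ∀ {m n} → m ≤ n → ∀ d e {s} → section m n d s → section m n e s → d ≡ e
section-unique {m} {n} m≤n d e p q =
  let (px , py) = section⇒Cell {m} {n} d p
      (qx , qy) = section⇒Cell {m} {n} e q
  in colrow-injective (Band-unique m≤n px qx) (Band-unique m≤n py qy)

section-next : ∀ {m n} d {s} → section m n d (rotate⁻¹ s) → section m n (next d) s
section-next {m} {n} d = Cell⇒section (next d) ∘ Cell-next {m} {n} d ∘ section⇒Cell d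

section-prev : ∀ {m n} d {s} → section m n (next d) s → section m n d (rotate⁻¹ s)
section-prev {m} {n} d = Cell⇒section d ∘ Cell-prev {m} {n} d ∘ section⇒Cell (next d)

------------------------------------------------------------------------
-- Sets counted by section

-- A number for each of the eight sections.
Counts : Set
Counts = Direction → ℕ

-- A lies in the (m,n)-frame and has ν d squares in the section d.
record Counted (m n : ℕ) (A : SquareSet) (ν : Counts) : Set where
  field
    covered : ∀ {s} → A s → ∃[ d ] section m n d s
    counted : ∀ d → HasSize (A ∩ section m n d) (ν d)
open Counted

directions : List Direction
directions = E ∷ NE ∷ N ∷ NW ∷ W ∷ SW ∷ S ∷ SE ∷ []

directions-unique : Unique directions
directions-unique = from-yes (unique? _≟_ directions)

∈-directions : ∀ d → d ∈ directions
∈-directions E  = here refl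
∈-directions NE = there (here refl)
∈-directions N  = there (there (here refl))
∈-directions NW = there (there (there (here refl)))
∈-directions W  = there (there (there (there (here refl))))
∈-directions SW = there (there (there (there (there (here refl)))))
∈-directions S  = there (there (there (there (there (there (here refl))))))
∈-directions SE = there (there (there (there (there (there (there (here refl)))))))

-- The union of disjoint sets indexed by a list of directions.
size-⋃ : (A : Direction → SquareSet) (ν : Counts) →
  (∀ {d e s} → A d s → A e s → d ≡ e) → (∀ d → HasSize (A d) (ν d)) →
  ∀ {ds} → Unique ds → HasSize (λ s → ∃[ d ] d ∈ ds × A d s) (sum (map ν ds))
size-⋃ A ν disjoint sizes [] = size-∅ (λ { (_ , () , _) })
size-⋃ A ν disjoint sizes {d ∷ ds} (d∉ds ∷ u) =
  size-cong
    ( [ (λ a → d , here refl , a) , (λ (e , e∈ds , a) → e , there e∈ds , a) ]′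
    , λ { (e , here refl , a) → inj₁ a ; (e , there e∈ds , a) → inj₂ (e , e∈ds , a) })
    (size-∪ (λ { a (e , e∈ds , a′) → All.lookup d∉ds e∈ds (disjoint a a′) })
      (sizes d) (size-⋃ A ν disjoint sizes u))

module _ {m n A ν} (m≤n : m ≤ n) (c : Counted m n A ν) where

  total : HasSize A (sum (map ν directions))
  total = size-cong
    ( (λ (_ , _ , a , _) → a)
    , λ a → let (d , sec) = covered c a in d , ∈-directions d , a , sec)
    (size-⋃ (λ d → A ∩ section m n d) ν
      (λ (_ , p) (_ , q) → section-unique m≤n _ _ p q) (counted c) directions-unique)

-- (i , j) stands for the strip between the grid lines i and j.
Strip : Set
Strip = ℕ × ℕ

-- The squares with x in the first strip and y in the second.
GridBox : ℕ → ℕ → Strip → Strip → SquareSet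
GridBox m n (i , j) (k , l) = Box (line m n i) (line m n j) (line m n k) (line m n l)

inside? : (r r′ : Strip) (d : Direction) →
  Dec ((proj₁ r ≤ col d × col d < proj₂ r) × (proj₁ r′ ≤ row d × row d < proj₂ r′))
inside? (i , j) (k , l) d =
  ((i ℕ.≤? col d) ×-dec (col d ℕ.<? j)) ×-dec ((k ℕ.≤? row d) ×-dec (row d ℕ.<? l))

-- The number of squares in the sections that lie in the given strips; the hole,
-- which has no direction, contributes nothing.
boxCount : Strip → Strip → Counts → ℕ
boxCount r r′ ν = sum (map ν (filter (inside? r r′) directions))

size-GridBox : ∀ {m n A ν} → m ≤ n → Counted m n A ν → ∀ r r′ →
  HasSize (A ∩ GridBox m n r r′) (boxCount r r′ ν)
size-GridBox {m} {n} {A} {ν} m≤n c r r′ = size-cong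
  ( (λ (d , d∈ , a , sec) →
      let (_ , (h , v)) = ∈-filter⁻ (inside? r r′) {xs = directions} d∈
          (p , q) = section⇒Cell {m} {n} d sec
      in a , Band⇒Segment m≤n h p , Band⇒Segment m≤n v q)
  , λ (a , h , v) →
      let (d , sec) = covered c a
          (p , q) = section⇒Cell {m} {n} d sec
      in d , ∈-filter⁺ (inside? r r′) (∈-directions d) (Band∩Segment m≤n p h , Band∩Segment m≤n q v) , a , sec)
  (size-⋃ (λ d → A ∩ section m n d) ν
    (λ (_ , p) (_ , q) → section-unique m≤n _ _ p q) (counted c)
    (Unique.filter⁺ (inside? r r′) directions-unique))

Counted-rotate : ∀ {m n A ν} → Counted m n A ν → Counted m n (A ∘ rotate) (ν ∘ next)
Counted-rotate {m} {n} c .covered {s} a =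
  let (d , sec) = covered c a
      d⁻ = next (next (next d))
  in d⁻ , subst (section m n d⁻) (rotate⁻¹-rotate s)
    (section-prev {m} {n} d⁻ (subst (λ e → section m n e (rotate s)) (sym (next⁴ d)) sec))
Counted-rotate {m} {n} c .counted d = size-cong
  ( (λ {s} (a , sec) → a ,
      subst (section m n d) (rotate⁻¹-rotate s) (section-prev {m} {n} d sec))
  , λ {s} (a , sec) → a ,
      section-next {m} {n} d (subst (section m n d) (sym (rotate⁻¹-rotate s)) sec))
  (size-rotate (counted c (next d)))

------------------------------------------------------------------------
-- The effect of a lifting on the counts

module _ (m n : ℕ) where
  -- For every set A counted by some ν, the set (A + v) ∩ B has K ν squares.
  PieceSize : Square → SquareSet → (Counts → ℕ) → Set₁
  PieceSize v B K = ∀ {A ν} → Counted m n A ν → HasSize (translate v A ∩ B) (K ν)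

  -- By rotating the whole configuration, A included, back by 90°.
  PieceSize-rotate : ∀ {v B K} → PieceSize v B K → PieceSize (rotate v) (rotateSet B) (K ∘ (_∘ next))
  PieceSize-rotate {v₁ , v₂} h {A} c = size-cong
    ( (λ {(x , y)} (a , b) → subst A (cong (_, y ℤ.- v₁) (eq x v₂)) a , b)
    , (λ {(x , y)} (a , b) → subst A (cong (_, y ℤ.- v₁) (sym (eq x v₂))) a , b))
    (size-rotateSet (h (Counted-rotate c)))
    where
    eq : ∀ x v → - (- x ℤ.- v) ≡ x ℤ.- (- v)
    eq = ℤ-solve-∀

  PieceSize-byRotation : ∀ {v v′ B B′ K K′} → PieceSize v B K → PieceSize v′ B′ K′ → ∀ d →
    PieceSize (byRotation rotate v v′ d) (byRotation rotateSet B B′ d)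
              (byRotation (λ L → L ∘ (_∘ next)) K K′ d)
  PieceSize-byRotation e ne E = e
  PieceSize-byRotation e ne NE = ne
  PieceSize-byRotation {K = K} e ne N = PieceSize-rotate {K = K} e
  PieceSize-byRotation {K′ = K} e ne NW = PieceSize-rotate {K = K} ne
  PieceSize-byRotation {K = K} e ne W = PieceSize-rotate {K = K ∘ (_∘ next)} (PieceSize-rotate {K = K} e)
  PieceSize-byRotation {K′ = K} e ne SW = PieceSize-rotate {K = K ∘ (_∘ next)} (PieceSize-rotate {K = K} ne)
  PieceSize-byRotation {K = K} e ne S =
    PieceSize-rotate {K = K ∘ (_∘ (next ∘ next))} (PieceSize-rotate {K = K ∘ (_∘ next)} (PieceSize-rotate {K = K} e))
  PieceSize-byRotation {K′ = K} e ne SE =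
    PieceSize-rotate {K = K ∘ (_∘ (next ∘ next))} (PieceSize-rotate {K = K ∘ (_∘ next)} (PieceSize-rotate {K = K} ne))

-- The grid lines and the proportions of the target frame as polynomials in m and n.
lineℤ : ℤ → ℤ → ℕ → ℤ
lineℤ m n 0 = - (m ℤ.+ n)
lineℤ m n 1 = m ℤ.- n
lineℤ m n 2 = n ℤ.- m
lineℤ m n _ = m ℤ.+ n

line≡lineℤ : ∀ m n k → line m n k ≡ lineℤ (+ m) (+ n) k
line≡lineℤ m n 0 = refl
line≡lineℤ m n 1 = sym (ℤ.m-n≡m⊖n m n)
line≡lineℤ m n 2 = sym (ℤ.m-n≡m⊖n n m)
line≡lineℤ m n (suc (suc (suc _))) = refl

targetℤ : Lifting → ℤ → ℤ → ℤ × ℤ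
targetℤ 𝕗 m n = m , + 2 ℤ.* m ℤ.+ n
targetℤ 𝕘 m n = n , + 2 ℤ.* n ℤ.- m
targetℤ 𝕙 m n = n , m ℤ.+ + 2 ℤ.* n

-- The subtraction in the case of 𝕘 is exact because m ≤ n.
target≡targetℤ : ∀ x {m n} → m ≤ n → let (m′ , n′) = target x (m , n) in
  (+ m′ , + n′) ≡ targetℤ x (+ m) (+ n)
target≡targetℤ 𝕗 {m} {n} _ = cong (λ i → + m , i ℤ.+ + n) (ℤ.pos-* 2 m)
target≡targetℤ 𝕘 {m} {n} m≤n = cong (+ n ,_) (begin
  + (2 * n ∸ m)           ≡⟨ ℤ.⊖-≥ (ℕ.≤-trans m≤n (ℕ.m≤m+n n _)) ⟨
  2 * n ⊖ m               ≡⟨ ℤ.m-n≡m⊖n (2 * n) m ⟨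
  + (2 * n) ℤ.- + m       ≡⟨ cong (ℤ._- + m) (ℤ.pos-* 2 n) ⟩
  + 2 ℤ.* + n ℤ.- + m     ∎)
  where open ≡-Reasoning
target≡targetℤ 𝕙 {m} {n} _ = cong (λ i → + n , + m ℤ.+ i) (ℤ.pos-* 2 n)

target-ordered : ∀ x {m n} → m ≤ n → proj₁ (target x (m , n)) ≤ proj₂ (target x (m , n))
target-ordered 𝕗 {m} {n} m≤n = ℕ.≤-trans m≤n (ℕ.m≤n+m n (2 * m))
target-ordered 𝕘 {m} {n} m≤n = subst (_≤ 2 * n ∸ m) (ℕ.m+n∸n≡m n m)
  (ℕ.∸-monoˡ-≤ m (ℕ.+-monoʳ-≤ n (ℕ.≤-trans m≤n (ℕ.m≤m+n n 0))))
target-ordered 𝕙 {m} {n} m≤n = ℕ.≤-trans (ℕ.m≤m+n n _) (ℕ.m≤n+m (2 * n) m)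

-- The strips of the old grid that the sections E and NE of the target frame
-- occupy when they are translated back: E lies in the strips eastX and eastY, and
-- NE lies in the strip corner in both coordinates.
eastX eastY corner : Lifting → Strip
eastX 𝕗 = 0 , 1
eastX 𝕘 = 1 , 3
eastX 𝕙 = 0 , 2
eastY 𝕗 = 0 , 3
eastY 𝕘 = 1 , 2
eastY 𝕙 = 0 , 3
corner 𝕗 = 2 , 3
corner 𝕘 = 0 , 2
corner 𝕙 = 1 , 3

-- The counts of a lifted set. Rotating the direction amounts to rotating the
-- counts.
liftCounts : Lifting → Counts → Counts
liftCounts x ν d =
  byRotation (λ L → L ∘ (_∘ next)) (boxCount (eastX x) (eastY x)) (boxCount (corner x) (corner x)) d ν

module _ {m n : ℕ} (m≤n : m ≤ n) where

  private
    module _ (x : Lifting) where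
      -- The grid lines of the target frame.
      line′ : ℕ → ℤ
      line′ = line (proj₁ (target x (m , n))) (proj₂ (target x (m , n)))
      lineℤ′ : ℤ → ℤ → ℕ → ℤ
      lineℤ′ a b = lineℤ (proj₁ (targetℤ x a b)) (proj₂ (targetℤ x a b))

      -- It suffices to compare grid lines as polynomials.
      line-shift : ∀ k i {u} (u′ : ℤ → ℤ → ℤ) → u ≡ u′ (+ m) (+ n) →
        (∀ a b → lineℤ′ a b k ≡ lineℤ a b i ℤ.+ + 2 ℤ.* u′ a b) →
        line′ k ≡ line m n i ℤ.+ + 2 ℤ.* u
      line-shift k i {u} u′ refl eq = begin
        line′ k                                         ≡⟨ line≡lineℤ _ _ k ⟩
        lineℤ (+ _) (+ _) k                             ≡⟨
          cong (λ ab → lineℤ (proj₁ ab) (proj₂ ab) k) (target≡targetℤ x m≤n) ⟩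
        lineℤ′ (+ m) (+ n) k                            ≡⟨ eq (+ m) (+ n) ⟩
        lineℤ (+ m) (+ n) i ℤ.+ + 2 ℤ.* u               ≡⟨ cong (λ l → l ℤ.+ + 2 ℤ.* u) (line≡lineℤ m n i) ⟨
        line m n i ℤ.+ + 2 ℤ.* u                        ∎
        where open ≡-Reasoning

      -- The strip between the lines k and l of the target frame, translated back by
      -- u, is the given strip of the grid.
      Pullback : (k l : ℕ) → Strip → ℤ → Set
      Pullback k l (i , j) u =
        line′ k ≡ line m n i ℤ.+ + 2 ℤ.* u × line′ l ≡ line m n j ℤ.+ + 2 ℤ.* u

  pullback-eastX : ∀ x → Pullback x 2 3 (eastX x) (proj₁ (shift x (m , n) E))
  pullback-eastX 𝕗 = line-shift 𝕗 2 0 (λ a b → a ℤ.+ b) refl lo , line-shift 𝕗 3 1 (λ a b → a ℤ.+ b) refl hi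
    where
    lo : ∀ a b → + 2 ℤ.* a ℤ.+ b ℤ.- a ≡ - (a ℤ.+ b) ℤ.+ + 2 ℤ.* (a ℤ.+ b)
    lo = ℤ-solve-∀
    hi : ∀ a b → a ℤ.+ (+ 2 ℤ.* a ℤ.+ b) ≡ a ℤ.- b ℤ.+ + 2 ℤ.* (a ℤ.+ b)
    hi = ℤ-solve-∀
  pullback-eastX 𝕘 =
    line-shift 𝕘 2 1 (λ a b → b ℤ.- a) (sym (ℤ.m-n≡m⊖n n m)) lo ,
    line-shift 𝕘 3 3 (λ a b → b ℤ.- a) (sym (ℤ.m-n≡m⊖n n m)) hi
    where
    lo : ∀ a b → + 2 ℤ.* b ℤ.- a ℤ.- b ≡ a ℤ.- b ℤ.+ + 2 ℤ.* (b ℤ.- a)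
    lo = ℤ-solve-∀
    hi : ∀ a b → b ℤ.+ (+ 2 ℤ.* b ℤ.- a) ≡ a ℤ.+ b ℤ.+ + 2 ℤ.* (b ℤ.- a)
    hi = ℤ-solve-∀
  pullback-eastX 𝕙 = line-shift 𝕙 2 0 (λ a b → a ℤ.+ b) refl lo , line-shift 𝕙 3 2 (λ a b → a ℤ.+ b) refl hi
    where
    lo : ∀ a b → a ℤ.+ + 2 ℤ.* b ℤ.- b ≡ - (a ℤ.+ b) ℤ.+ + 2 ℤ.* (a ℤ.+ b)
    lo = ℤ-solve-∀
    hi : ∀ a b → b ℤ.+ (a ℤ.+ + 2 ℤ.* b) ≡ b ℤ.- a ℤ.+ + 2 ℤ.* (a ℤ.+ b)
    hi = ℤ-solve-∀

  pullback-eastY : ∀ x → Pullback x 1 2 (eastY x) (+ 0)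
  pullback-eastY 𝕗 = line-shift 𝕗 1 0 (λ a b → + 0) refl lo , line-shift 𝕗 2 3 (λ a b → + 0) refl hi
    where
    lo : ∀ a b → a ℤ.- (+ 2 ℤ.* a ℤ.+ b) ≡ - (a ℤ.+ b) ℤ.+ + 0
    lo = ℤ-solve-∀
    hi : ∀ a b → + 2 ℤ.* a ℤ.+ b ℤ.- a ≡ a ℤ.+ b ℤ.+ + 0
    hi = ℤ-solve-∀
  pullback-eastY 𝕘 = line-shift 𝕘 1 1 (λ a b → + 0) refl lo , line-shift 𝕘 2 2 (λ a b → + 0) refl hi
    where
    lo : ∀ a b → b ℤ.- (+ 2 ℤ.* b ℤ.- a) ≡ a ℤ.- b ℤ.+ + 0
    lo = ℤ-solve-∀
    hi : ∀ a b → + 2 ℤ.* b ℤ.- a ℤ.- b ≡ b ℤ.- a ℤ.+ + 0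
    hi = ℤ-solve-∀
  pullback-eastY 𝕙 = line-shift 𝕙 1 0 (λ a b → + 0) refl lo , line-shift 𝕙 2 3 (λ a b → + 0) refl hi
    where
    lo : ∀ a b → b ℤ.- (a ℤ.+ + 2 ℤ.* b) ≡ - (a ℤ.+ b) ℤ.+ + 0
    lo = ℤ-solve-∀
    hi : ∀ a b → a ℤ.+ + 2 ℤ.* b ℤ.- b ≡ a ℤ.+ b ℤ.+ + 0
    hi = ℤ-solve-∀

  -- The two components of the shift of NE agree.
  cornerShift : Lifting → ℤ
  cornerShift x = proj₁ (shift x (m , n) NE)

  pullback-corner : ∀ x → Pullback x 2 3 (corner x) (cornerShift x)
  pullback-corner 𝕗 = line-shift 𝕗 2 2 (λ a b → a) refl lo , line-shift 𝕗 3 3 (λ a b → a) refl hi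
    where
    lo : ∀ a b → + 2 ℤ.* a ℤ.+ b ℤ.- a ≡ b ℤ.- a ℤ.+ + 2 ℤ.* a
    lo = ℤ-solve-∀
    hi : ∀ a b → a ℤ.+ (+ 2 ℤ.* a ℤ.+ b) ≡ a ℤ.+ b ℤ.+ + 2 ℤ.* a
    hi = ℤ-solve-∀
  pullback-corner 𝕘 = line-shift 𝕘 2 0 (λ a b → b) refl lo , line-shift 𝕘 3 2 (λ a b → b) refl hi
    where
    lo : ∀ a b → + 2 ℤ.* b ℤ.- a ℤ.- b ≡ - (a ℤ.+ b) ℤ.+ + 2 ℤ.* b
    lo = ℤ-solve-∀
    hi : ∀ a b → b ℤ.+ (+ 2 ℤ.* b ℤ.- a) ≡ b ℤ.- a ℤ.+ + 2 ℤ.* b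
    hi = ℤ-solve-∀
  pullback-corner 𝕙 = line-shift 𝕙 2 1 (λ a b → b) refl lo , line-shift 𝕙 3 3 (λ a b → b) refl hi
    where
    lo : ∀ a b → a ℤ.+ + 2 ℤ.* b ℤ.- b ≡ a ℤ.- b ℤ.+ + 2 ℤ.* b
    lo = ℤ-solve-∀
    hi : ∀ a b → b ℤ.+ (a ℤ.+ + 2 ℤ.* b) ≡ a ℤ.+ b ℤ.+ + 2 ℤ.* b
    hi = ℤ-solve-∀

  PieceSize-Box : ∀ {a b c d} r r′ (u v : ℤ) →
    a ≡ line m n (proj₁ r) ℤ.+ + 2 ℤ.* u × b ≡ line m n (proj₂ r) ℤ.+ + 2 ℤ.* u →
    c ≡ line m n (proj₁ r′) ℤ.+ + 2 ℤ.* v × d ≡ line m n (proj₂ r′) ℤ.+ + 2 ℤ.* v →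
    PieceSize m n (u , v) (Box a b c d) (boxCount r r′)
  PieceSize-Box r r′ u v (e₁ , e₂) (e₃ , e₄) cnt = size-cong
    ( (λ {(x , y)} (a , h , w) → a , proj₂ (Segment-shift u e₁ e₂ x) h , proj₂ (Segment-shift v e₃ e₄ y) w)
    , λ {(x , y)} (a , h , w) → a , proj₁ (Segment-shift u e₁ e₂ x) h , proj₁ (Segment-shift v e₃ e₄ y) w)
    (size-translate (u , v) (size-GridBox m≤n cnt r r′))

  PieceSize-rotated : ∀ x {u u′} →
    Pullback x 2 3 (eastX x) u → Pullback x 1 2 (eastY x) (+ 0) → Pullback x 2 3 (corner x) u′ → ∀ d →
    PieceSize m n (byRotation rotate (u , + 0) (u′ , u′) d)
      (section (proj₁ (target x (m , n))) (proj₂ (target x (m , n))) d) (λ ν → liftCounts x ν d)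
  PieceSize-rotated x {u} {u′} e₁ e₂ e₃ = PieceSize-byRotation m n
    {K = boxCount (eastX x) (eastY x)} {K′ = boxCount (corner x) (corner x)}
    (PieceSize-Box (eastX x) (eastY x) u (+ 0) e₁ e₂) (PieceSize-Box (corner x) (corner x) u′ u′ e₃ e₃)

  PieceSize-lift : ∀ x d → PieceSize m n (shift x (m , n) d)
    (section (proj₁ (target x (m , n))) (proj₂ (target x (m , n))) d) (λ ν → liftCounts x ν d)
  PieceSize-lift 𝕗 = PieceSize-rotated 𝕗 (pullback-eastX 𝕗) (pullback-eastY 𝕗) (pullback-corner 𝕗)
  PieceSize-lift 𝕘 = PieceSize-rotated 𝕘 (pullback-eastX 𝕘) (pullback-eastY 𝕘) (pullback-corner 𝕘)
  PieceSize-lift 𝕙 = PieceSize-rotated 𝕙 (pullback-eastX 𝕙) (pullback-eastY 𝕙) (pullback-corner 𝕙)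

  Counted-lift : ∀ x {A ν} → Counted m n A ν →
    let (m′ , n′) = target x (m , n) in Counted m′ n′ (lift x (m , n) A) (liftCounts x ν)
  Counted-lift x c .Counted.covered (d , _ , sec) = d , sec
  Counted-lift x {A} c .Counted.counted d = size-cong
    ( (λ (a , sec) → (d , a , sec) , sec)
    , λ {s} ((e , a , sec) , sec′) →
        subst (λ i → translate (shift x (m , n) i) A s) (section-unique (target-ordered x m≤n) e d sec sec′) a , sec′)
    (PieceSize-lift x d c)

-- The quantities s and c.
sides corners : Counts → ℕ
sides ν   = ν E + ν N + ν W + ν S
corners ν = ν NE + ν NW + ν SW + ν SE

-- The action of a lifting on the pair (s , c).
act : Lifting → ℕ × ℕ → ℕ × ℕ
act 𝕗 (s , c) = s + 2 * c , c
act 𝕘 (s , c) = s , c + 2 * s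
act 𝕙 (s , c) = 3 * s + 2 * c , c + 2 * s

-- The left-hand sides of the identities list, for the target sections E, N, W, S
-- in this order, the old sections that are moved there.
act-sides : ∀ x ν → sides (liftCounts x ν) ≡ proj₁ (act x (sides ν , corners ν))
act-sides 𝕗 ν = eq (ν E) (ν N) (ν W) (ν S) (ν NE) (ν NW) (ν SW) (ν SE)
  where
  eq : ∀ e n w s ne nw sw se →
    (nw + (w + (sw + 0))) + (sw + (s + (se + 0))) + (se + (e + (ne + 0))) + (ne + (n + (nw + 0))) ≡
    (e + n + w + s) + 2 * (ne + nw + sw + se)
  eq = ℕ-solve-∀
act-sides 𝕘 ν = eq (ν E) (ν N) (ν W) (ν S) (ν NE) (ν NW) (ν SW) (ν SE)
  where
  eq : ∀ e n w s ne nw sw se →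
    (e + 0) + (n + 0) + (w + 0) + (s + 0) ≡
    (e + n + w + s)
  eq = ℕ-solve-∀
act-sides 𝕙 ν = eq (ν E) (ν N) (ν W) (ν S) (ν NE) (ν NW) (ν SW) (ν SE)
  where
  eq : ∀ e n w s ne nw sw se →
    (n + (nw + (w + (sw + (s + 0))))) + (w + (sw + (s + (se + (e + 0))))) + (s + (se + (e + (ne + (n + 0))))) + (e + (ne + (n + (nw + (w + 0))))) ≡
    3 * (e + n + w + s) + 2 * (ne + nw + sw + se)
  eq = ℕ-solve-∀

-- The same for the target sections NE, NW, SW, SE.
act-corners : ∀ x ν → corners (liftCounts x ν) ≡ proj₂ (act x (sides ν , corners ν))
act-corners 𝕗 ν = eq (ν E) (ν N) (ν W) (ν S) (ν NE) (ν NW) (ν SW) (ν SE)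
  where
  eq : ∀ e n w s ne nw sw se →
    (ne + 0) + (nw + 0) + (sw + 0) + (se + 0) ≡
    (ne + nw + sw + se)
  eq = ℕ-solve-∀
act-corners 𝕘 ν = eq (ν E) (ν N) (ν W) (ν S) (ν NE) (ν NW) (ν SW) (ν SE)
  where
  eq : ∀ e n w s ne nw sw se →
    (w + (sw + (s + 0))) + (s + (se + (e + 0))) + (e + (ne + (n + 0))) + (n + (nw + (w + 0))) ≡
    (ne + nw + sw + se) + 2 * (e + n + w + s)
  eq = ℕ-solve-∀
act-corners 𝕙 ν = eq (ν E) (ν N) (ν W) (ν S) (ν NE) (ν NW) (ν SW) (ν SE)
  where
  eq : ∀ e n w s ne nw sw se →
    (e + (ne + (n + 0))) + (n + (nw + (w + 0))) + (w + (sw + (s + 0))) + (s + (se + (e + 0))) ≡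
    (ne + nw + sw + se) + 2 * (e + n + w + s)
  eq = ℕ-solve-∀

------------------------------------------------------------------------
-- Sides and corners alternate along a shell cycle

-- Whether a section is a side rather than a corner.
isSide : Direction → Bool
isSide = byRotation id true false

isSide-next : ∀ d → isSide (next d) ≡ isSide d
isSide-next E = refl
isSide-next NE = refl
isSide-next N = refl
isSide-next NW = refl
isSide-next W = refl
isSide-next SW = refl
isSide-next S = refl
isSide-next SE = refl

-- A coordinate z of a shell square is small if 2|z| < m, long if 2|z| < 2n - m,
-- and in the ring if m < 2|z| < 3m.
Small : ℕ → ℤ → Set
Small m = Segment (- + m) (+ m)

Long : ℕ → ℕ → ℤ → Set
Long m n = Segment (- (+ 2 ℤ.* + n ℤ.- + m)) (+ 2 ℤ.* + n ℤ.- + m)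

Ring : ℕ → ℤ → Set
Ring m z = Segment (+ m) (+ 3 ℤ.* + m) z ⊎ Segment (+ m) (+ 3 ℤ.* + m) (- z)

-- The positions possible for side squares (true) and corner squares (false) of
-- a shell. These bounds hold for both forms of the shell.
Zone : ℕ → ℕ → Bool → SquareSet
Zone m n true  (x , y) = Long m n x × Small m y ⊎ Small m x × Long m n y
Zone m n false (x , y) = Ring m x × Ring m y

Ring-neg : ∀ {m z} → Ring m (- z) → Ring m z
Ring-neg (inj₁ p) = inj₂ p
Ring-neg {m} (inj₂ p) = inj₁ (subst (Segment _ _) (ℤ.neg-involutive _) p)

Zone-rotate⁻¹ : ∀ {m n} b {s} → Zone m n b (rotate⁻¹ s) → Zone m n b s
Zone-rotate⁻¹ true (inj₁ (p , q)) = inj₂ (Segment-neg refl (sym (ℤ.neg-involutive _)) q , p)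
Zone-rotate⁻¹ true (inj₂ (p , q)) = inj₁ (Segment-neg refl (sym (ℤ.neg-involutive _)) q , p)
Zone-rotate⁻¹ false (p , q) = Ring-neg q , p

-- A step of length k does not lie in the interval |z| < c/2 when c ≤ 2k.
step-outside : ∀ σ k {c} → c ℤ.≤ + 2 ℤ.* + k → ¬ Segment (- c) c (σ ◃ k)
step-outside Sign.+ k c≤2k (_ , lt) =
  ℤ.<⇒≱ (subst (λ i → + 2 ℤ.* i ℤ.< _) (ℤ.+◃n≡+n k) lt) c≤2k
step-outside Sign.- k {c} c≤2k (lt , _) =
  ℤ.<⇒≱ (<-by (subst (λ i → - c ℤ.< + 2 ℤ.* i) (ℤ.-◃n≡-n k) lt) (eq c (+ k))) c≤2k
  where
  eq : ∀ c k → - c ℤ.- + 2 ℤ.* - k ≡ + 2 ℤ.* k ℤ.- c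
  eq = ℤ-solve-∀

-- A step of length k is not larger than k.
not-above : ∀ σ k {d} → ¬ Segment (+ 2 ℤ.* + k) d (σ ◃ k)
not-above Sign.+ k (lt , _) = ℤ.<-irrefl refl (subst (λ i → + 2 ℤ.* + k ℤ.< + 2 ℤ.* i) (ℤ.+◃n≡+n k) lt)
not-above Sign.- k (lt , _) = ℤ.<⇒≱ (subst (λ i → + 2 ℤ.* + k ℤ.< + 2 ℤ.* i) (ℤ.-◃n≡-n k) lt)
  (ℤ.*-monoˡ-≤-nonNeg (+ 2) (ℤ.neg-≤-pos {k} {k}))

◃-neg : ∀ σ k → - (σ ◃ k) ≡ Sign.opposite σ ◃ k
◃-neg Sign.+ k = trans (cong -_ (ℤ.+◃n≡+n k)) (sym (ℤ.-◃n≡-n k))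
◃-neg Sign.- k = trans (cong -_ (ℤ.-◃n≡-n k)) (trans (ℤ.neg-involutive (+ k)) (sym (ℤ.+◃n≡+n k)))

-- Points of the intervals |z| < a/2 and |z| < b/2 differ by less than (a + b)/2.
too-far : ∀ σ k {a b z} → a ℤ.+ b ℤ.≤ + 2 ℤ.* + k →
  Segment (- a) a z → Segment (- b) b (z ℤ.+ (σ ◃ k)) → ⊥
too-far σ k {a} {b} {z} a+b≤2k p q = step-outside σ k a+b≤2k
  (Segment-cong (eq₁ a b) (eq₂ a b) (eq z (σ ◃ k))
    (Segment-+ {z = - z} {z ℤ.+ (σ ◃ k)} (Segment-sym {z = z} p) q))
  where
  eq : ∀ z w → - z ℤ.+ (z ℤ.+ w) ≡ w
  eq = ℤ-solve-∀
  eq₁ : ∀ a b → - a ℤ.+ - b ≡ - (a ℤ.+ b)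
  eq₁ = ℤ-solve-∀
  eq₂ : ∀ a b → - (- a) ℤ.+ b ≡ a ℤ.+ b
  eq₂ = ℤ-solve-∀

-- Points of the ring with the same sign are closer than m, and points of
-- opposite signs are farther apart than m.
Ring-step⁺ : ∀ σ m {z} → Segment (+ m) (+ 3 ℤ.* + m) z → ¬ Ring m (z ℤ.+ (σ ◃ m))
Ring-step⁺ σ m {z} p (inj₁ q) = step-outside σ m ℤ.≤-refl
  (Segment-cong (eq₁ (+ m)) (eq₂ (+ m)) (eq z (σ ◃ m))
    (Segment-+ {z = - z} {z ℤ.+ (σ ◃ m)} (Segment-sym {z = z} p) q))
  where
  eq : ∀ z w → - z ℤ.+ (z ℤ.+ w) ≡ w
  eq = ℤ-solve-∀
  eq₁ : ∀ a → - (+ 3 ℤ.* a) ℤ.+ a ≡ - (+ 2 ℤ.* a)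
  eq₁ = ℤ-solve-∀
  eq₂ : ∀ a → - a ℤ.+ + 3 ℤ.* a ≡ + 2 ℤ.* a
  eq₂ = ℤ-solve-∀
Ring-step⁺ σ m {z} p (inj₂ q) = not-above (Sign.opposite σ) m
  (Segment-cong (eq₁ (+ m)) refl (trans (eq z (σ ◃ m)) (◃-neg σ m))
    (Segment-+ {z = z} { - (z ℤ.+ (σ ◃ m))} p q))
  where
  eq : ∀ z w → z ℤ.+ - (z ℤ.+ w) ≡ - w
  eq = ℤ-solve-∀
  eq₁ : ∀ a → a ℤ.+ a ≡ + 2 ℤ.* a
  eq₁ = ℤ-solve-∀

Ring-step : ∀ σ m {z} → Ring m z → ¬ Ring m (z ℤ.+ (σ ◃ m))
Ring-step σ m (inj₁ p) q = Ring-step⁺ σ m p q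
Ring-step σ m {z} (inj₂ p) q = Ring-step⁺ (Sign.opposite σ) m p
  (subst (Ring m) (trans (ℤ.neg-distrib-+ z (σ ◃ m)) (cong (λ i → - z ℤ.+ i) (◃-neg σ m)))
    (Ring-neg {z = - (z ℤ.+ (σ ◃ m))} (subst (Ring m) (sym (ℤ.neg-involutive _)) q)))

module _ {m n : ℕ} (m≤n : m ≤ n) where

  Small-step : ∀ σ k {z} → m ≤ k → Small m z → ¬ Small m (z ℤ.+ (σ ◃ k))
  Small-step σ k m≤k = too-far σ k (subst (ℤ._≤ + 2 ℤ.* + k) (eq (+ m)) (ℤ.*-monoˡ-≤-nonNeg (+ 2) (ℤ.+≤+ m≤k)))
    where
    eq : ∀ a → + 2 ℤ.* a ≡ a ℤ.+ a
    eq = ℤ-solve-∀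

  Small-Long-step : ∀ σ {z} → Small m z → ¬ Long m n (z ℤ.+ (σ ◃ n))
  Small-Long-step σ = too-far σ n (ℤ.≤-reflexive (eq (+ m) (+ n)))
    where
    eq : ∀ a b → a ℤ.+ (+ 2 ℤ.* b ℤ.- a) ≡ + 2 ℤ.* b
    eq = ℤ-solve-∀

  Long-Small-step : ∀ σ {z} → Long m n z → ¬ Small m (z ℤ.+ (σ ◃ n))
  Long-Small-step σ = too-far σ n (ℤ.≤-reflexive (eq (+ m) (+ n)))
    where
    eq : ∀ a b → + 2 ℤ.* b ℤ.- a ℤ.+ a ≡ + 2 ℤ.* b
    eq = ℤ-solve-∀

  -- Between two side squares, a contradiction comes from the coordinate in which both
  -- are small or, if there is none, from the one that changes by ±n; between two
  -- corner squares, from the one that changes by ±m.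
  Zone-alternates : ∀ b c {s t} → Move m n s t → Zone m n b s → Zone m n c t → c ≡ not b
  Zone-alternates true false _ _ _ = refl
  Zone-alternates false true _ _ _ = refl
  Zone-alternates true true (σ , τ , inj₁ refl) (inj₁ (_ , p)) (inj₁ (_ , q)) = ⊥-elim (Small-step τ n m≤n p q)
  Zone-alternates true true (σ , τ , inj₁ refl) (inj₁ (_ , p)) (inj₂ (_ , q)) = ⊥-elim (Small-Long-step τ p q)
  Zone-alternates true true (σ , τ , inj₁ refl) (inj₂ (_ , p)) (inj₁ (_ , q)) = ⊥-elim (Long-Small-step τ p q)
  Zone-alternates true true (σ , τ , inj₁ refl) (inj₂ (p , _)) (inj₂ (q , _)) = ⊥-elim (Small-step σ m ℕ.≤-refl p q)
  Zone-alternates true true (σ , τ , inj₂ refl) (inj₁ (_ , p)) (inj₁ (_ , q)) = ⊥-elim (Small-step τ m ℕ.≤-refl p q)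
  Zone-alternates true true (σ , τ , inj₂ refl) (inj₁ (p , _)) (inj₂ (q , _)) = ⊥-elim (Long-Small-step σ p q)
  Zone-alternates true true (σ , τ , inj₂ refl) (inj₂ (p , _)) (inj₁ (q , _)) = ⊥-elim (Small-Long-step σ p q)
  Zone-alternates true true (σ , τ , inj₂ refl) (inj₂ (p , _)) (inj₂ (q , _)) = ⊥-elim (Small-step σ n m≤n p q)
  Zone-alternates false false (σ , τ , inj₁ refl) (p , _) (q , _) = ⊥-elim (Ring-step σ m p q)
  Zone-alternates false false (σ , τ , inj₂ refl) (_ , p) (_ , q) = ⊥-elim (Ring-step τ m p q)

------------------------------------------------------------------------
-- The position of the squares of the shell

-- A square in the section d that has the position required of shell squares.
Placed : ℕ → ℕ → Direction → SquareSet
Placed m n d s = section m n d s × Zone m n (isSide d) s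

Placed-next : ∀ {m n} d {s} → Placed m n d (rotate⁻¹ s) → Placed m n (next d) s
Placed-next {m} {n} d {s} (sec , zone) =
  section-next {m} {n} d sec ,
  subst (λ b → Zone m n b s) (sym (isSide-next d)) (Zone-rotate⁻¹ {m} {n} (isSide d) zone)

⊖≡ : ∀ i j {a b} → + i ≡ a → + j ≡ b → i ⊖ j ≡ a ℤ.- b
⊖≡ i j refl refl = sym (ℤ.m-n≡m⊖n i j)

-- An inequality between quantities equal to polynomials c′ and d′.
≤-via : ∀ {a b c d c′ d′} → a ℤ.≤ b → c ≡ c′ → d ≡ d′ → a ℤ.- b ≡ c′ ℤ.- d′ → c ℤ.≤ d
≤-via a≤b refl refl eq = ≤-by a≤b eq

double : ∀ {a b} → a ℤ.≤ b → + 2 ℤ.* a ℤ.≤ + 2 ℤ.* b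
double = ℤ.*-monoˡ-≤-nonNeg (+ 2)

module _ {m n : ℕ} where
  private
    μ η : ℤ
    μ = + m
    η = + n

    n⊖m : n ⊖ m ≡ η ℤ.- μ
    n⊖m = ⊖≡ n m refl refl
    m⊖n : m ⊖ n ≡ μ ℤ.- η
    m⊖n = ⊖≡ m n refl refl

  -- The subboards would be empty if n < m, so the existence of a square forces m ≤ n.
  shell₁⇒≤ : ∀ {s d} → shell₁ m n d s → m ≤ n
  shell₁⇒≤ {s} {d} = byRotation-⊆ (λ _ _ → m ≤ n) (λ _ → id)
    (λ ((p , q) , _) → ℤ.drop‿+≤+ (ℤ.≮⇒≥ λ n<m →
       ℤ.<⇒≱ (ℤ.<-trans p q) (≤-via (double (ℤ.<⇒≤ n<m)) (cong (+ 3 ℤ.*_) n⊖m) n⊖m (eqE μ η))))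
    (λ ((p , q) , _) → ℤ.drop‿+≤+ (ℤ.≮⇒≥ λ n<m →
       ℤ.<⇒≱ (ℤ.<-trans p q) (≤-via (double (ℤ.<⇒≤ n<m)) refl (⊖≡ (3 * m) n (ℤ.pos-* 3 m) refl) (eqNE μ η))))
    d
    where
    eqE : ∀ a b → + 2 ℤ.* b ℤ.- + 2 ℤ.* a ≡ + 3 ℤ.* (b ℤ.- a) ℤ.- (b ℤ.- a)
    eqE = ℤ-solve-∀
    eqNE : ∀ a b → + 2 ℤ.* b ℤ.- + 2 ℤ.* a ≡ (a ℤ.+ b) ℤ.- (+ 3 ℤ.* a ℤ.- b)
    eqNE = ℤ-solve-∀

  long-below : m ≤ n → - (+ 2 ℤ.* η ℤ.- μ) ℤ.≤ n ⊖ m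
  long-below m≤n = ≤-via (ℤ.+-mono-≤ (double (ℤ.+≤+ m≤n)) (ℤ.+≤+ (z≤n {n}))) refl n⊖m (eq μ η)
    where
    eq : ∀ a b → + 2 ℤ.* a ℤ.+ + 0 ℤ.- (+ 2 ℤ.* b ℤ.+ b) ≡ - (+ 2 ℤ.* b ℤ.- a) ℤ.- (b ℤ.- a)
    eq = ℤ-solve-∀

  shell₁-placed : n ≤ 2 * m → ∀ d {s} → shell₁ m n d s → Placed m n d s
  shell₁-placed n≤2m d {s} sh = byRotation-⊆ (Placed m n) (λ d → Placed-next {m} {n} d)
    (λ (p , q) → (Segment-⊆ ℤ.≤-refl (≤-via (double h) (cong (+ 3 ℤ.*_) n⊖m) refl (e₁ μ η)) p , q) ,
      inj₁ (Segment-⊆ (long-below m≤n) (≤-via h (cong (+ 3 ℤ.*_) n⊖m) refl (e₂ μ η)) p ,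
            Segment-⊆ (≤-via h refl m⊖n (e₃ μ η)) (≤-via h n⊖m refl (e₄ μ η)) q))
    (λ (p , q) → (Segment-⊆ c₁ ℤ.≤-refl p , Segment-⊆ c₁ ℤ.≤-refl q) ,
      (inj₁ (Segment-⊆ c₂ c₃ p) , inj₁ (Segment-⊆ c₂ c₃ q)))
    d sh
    where
    m≤n = shell₁⇒≤ {s} {d} sh
    h : η ℤ.≤ + 2 ℤ.* μ
    h = subst (η ℤ.≤_) (ℤ.pos-* 2 m) (ℤ.+≤+ n≤2m)
    3m⊖n = ⊖≡ (3 * m) n (ℤ.pos-* 3 m) refl
    e₁ : ∀ a b → + 2 ℤ.* b ℤ.- + 2 ℤ.* (+ 2 ℤ.* a) ≡ + 3 ℤ.* (b ℤ.- a) ℤ.- (a ℤ.+ b)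
    e₁ = ℤ-solve-∀
    e₂ : ∀ a b → b ℤ.- + 2 ℤ.* a ≡ + 3 ℤ.* (b ℤ.- a) ℤ.- (+ 2 ℤ.* b ℤ.- a)
    e₂ = ℤ-solve-∀
    e₃ : ∀ a b → b ℤ.- + 2 ℤ.* a ≡ - a ℤ.- (a ℤ.- b)
    e₃ = ℤ-solve-∀
    e₄ : ∀ a b → b ℤ.- + 2 ℤ.* a ≡ b ℤ.- a ℤ.- a
    e₄ = ℤ-solve-∀
    c₁ : n ⊖ m ℤ.≤ 3 * m ⊖ n
    c₁ = ≤-via (double h) n⊖m 3m⊖n (eq μ η)
      where
      eq : ∀ a b → + 2 ℤ.* b ℤ.- + 2 ℤ.* (+ 2 ℤ.* a) ≡ b ℤ.- a ℤ.- (+ 3 ℤ.* a ℤ.- b)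
      eq = ℤ-solve-∀
    c₂ : μ ℤ.≤ 3 * m ⊖ n
    c₂ = ≤-via h refl 3m⊖n (eq μ η)
      where
      eq : ∀ a b → b ℤ.- + 2 ℤ.* a ≡ a ℤ.- (+ 3 ℤ.* a ℤ.- b)
      eq = ℤ-solve-∀
    c₃ : μ ℤ.+ η ℤ.≤ + 3 ℤ.* μ
    c₃ = ≤-by h (eq μ η)
      where
      eq : ∀ a b → b ℤ.- + 2 ℤ.* a ≡ a ℤ.+ b ℤ.- + 3 ℤ.* a
      eq = ℤ-solve-∀

  shell₂-placed : 2 * m ≤ n → ∀ d {s} → shell₂ m n d s → Placed m n d s
  shell₂-placed 2m≤n = byRotation-⊆ (Placed m n) (λ d → Placed-next {m} {n} d)
    (λ (p , q) → (Segment-⊆ a₁ ℤ.≤-refl p , Segment-⊆ a₂ a₃ q) ,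
      inj₁ (Segment-⊆ (ℤ.≤-trans (long-below m≤n) a₁) a₄ p , Segment-⊆ a₅ a₆ q))
    (λ (p , q) → (Segment-⊆ ℤ.≤-refl b₁ p , Segment-⊆ ℤ.≤-refl b₁ q) ,
      (inj₁ (Segment-⊆ b₂ b₃ p) , inj₁ (Segment-⊆ b₂ b₃ q)))
    where
    m≤n = ℕ.≤-trans (ℕ.m≤m+n m _) 2m≤n
    h : + 2 ℤ.* μ ℤ.≤ η
    h = subst (ℤ._≤ η) (ℤ.pos-* 2 m) (ℤ.+≤+ 2m≤n)
    3n⊖5m = ⊖≡ (3 * n) (5 * m) (ℤ.pos-* 3 n) (ℤ.pos-* 5 m)
    3m⊖n = ⊖≡ (3 * m) n (ℤ.pos-* 3 m) refl
    n⊖3m = ⊖≡ n (3 * m) refl (ℤ.pos-* 3 m)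
    5m⊖n = ⊖≡ (5 * m) n (ℤ.pos-* 5 m) refl
    a₁ : n ⊖ m ℤ.≤ 3 * n ⊖ 5 * m
    a₁ = ≤-via (double h) n⊖m 3n⊖5m (eq μ η)
      where
      eq : ∀ a b → + 2 ℤ.* (+ 2 ℤ.* a) ℤ.- + 2 ℤ.* b ≡ b ℤ.- a ℤ.- (+ 3 ℤ.* b ℤ.- + 5 ℤ.* a)
      eq = ℤ-solve-∀
    a₂ : m ⊖ n ℤ.≤ n ⊖ 3 * m
    a₂ = ≤-via (double h) m⊖n n⊖3m (eq μ η)
      where
      eq : ∀ a b → + 2 ℤ.* (+ 2 ℤ.* a) ℤ.- + 2 ℤ.* b ≡ a ℤ.- b ℤ.- (b ℤ.- + 3 ℤ.* a)
      eq = ℤ-solve-∀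
    a₃ : 3 * m ⊖ n ℤ.≤ n ⊖ m
    a₃ = ≤-via (double h) 3m⊖n n⊖m (eq μ η)
      where
      eq : ∀ a b → + 2 ℤ.* (+ 2 ℤ.* a) ℤ.- + 2 ℤ.* b ≡ + 3 ℤ.* a ℤ.- b ℤ.- (b ℤ.- a)
      eq = ℤ-solve-∀
    a₄ : μ ℤ.+ η ℤ.≤ + 2 ℤ.* η ℤ.- μ
    a₄ = ≤-by h (eq μ η)
      where
      eq : ∀ a b → + 2 ℤ.* a ℤ.- b ≡ a ℤ.+ b ℤ.- (+ 2 ℤ.* b ℤ.- a)
      eq = ℤ-solve-∀
    a₅ : - μ ℤ.≤ n ⊖ 3 * m
    a₅ = ≤-via h refl n⊖3m (eq μ η)
      where
      eq : ∀ a b → + 2 ℤ.* a ℤ.- b ≡ - a ℤ.- (b ℤ.- + 3 ℤ.* a)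
      eq = ℤ-solve-∀
    a₆ : 3 * m ⊖ n ℤ.≤ μ
    a₆ = ≤-via h 3m⊖n refl (eq μ η)
      where
      eq : ∀ a b → + 2 ℤ.* a ℤ.- b ≡ + 3 ℤ.* a ℤ.- b ℤ.- a
      eq = ℤ-solve-∀
    b₁ : 5 * m ⊖ n ℤ.≤ μ ℤ.+ η
    b₁ = ≤-via (double h) 5m⊖n refl (eq μ η)
      where
      eq : ∀ a b → + 2 ℤ.* (+ 2 ℤ.* a) ℤ.- + 2 ℤ.* b ≡ + 5 ℤ.* a ℤ.- b ℤ.- (a ℤ.+ b)
      eq = ℤ-solve-∀
    b₂ : μ ℤ.≤ n ⊖ m
    b₂ = ≤-via h refl n⊖m (eq μ η)
      where
      eq : ∀ a b → + 2 ℤ.* a ℤ.- b ≡ a ℤ.- (b ℤ.- a)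
      eq = ℤ-solve-∀
    b₃ : 5 * m ⊖ n ℤ.≤ + 3 ℤ.* μ
    b₃ = ≤-via h 5m⊖n refl (eq μ η)
      where
      eq : ∀ a b → + 2 ℤ.* a ℤ.- b ≡ + 5 ℤ.* a ℤ.- b ℤ.- + 3 ℤ.* a
      eq = ℤ-solve-∀

  Shell⇒≤ : ∀ {s} → Shell m n s → m ≤ n
  Shell⇒≤ (inj₁ (_ , d , sh)) = shell₁⇒≤ {d = d} sh
  Shell⇒≤ (inj₂ (2m≤n , _)) = ℕ.≤-trans (ℕ.m≤m+n m _) 2m≤n

  Shell-placed : ∀ {s} → Shell m n s → ∃[ d ] Placed m n d s
  Shell-placed (inj₁ (n≤2m , d , sh)) = d , shell₁-placed n≤2m d sh
  Shell-placed (inj₂ (2m≤n , _ , d , sh)) = d , shell₂-placed 2m≤n d sh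

------------------------------------------------------------------------
-- The counts of a shell cycle

-- Adds one square in the section d.
bump : Direction → Counts → Counts
bump d ν e = if does (d ≟ e) then suc (ν e) else ν e

-- The counts of a list of squares, each with the section it is in.
tally : ∀ {P : Direction → SquareSet} {xs} → All (λ s → ∃[ d ] P d s) xs → Counts
tally [] _ = 0
tally ((d , _) ∷ ps) = bump d (tally ps)

Counted-tally : ∀ {m n xs} → m ≤ n → Unique xs → (ps : All (λ s → ∃[ d ] Placed m n d s) xs) →
  Counted m n (_∈ xs) (tally ps)
Counted-tally m≤n u ps .Counted.covered s∈xs =
  let (d , sec , _) = All.lookup ps s∈xs in d , sec
Counted-tally m≤n u [] .Counted.counted e = size-∅ λ ()
Counted-tally m≤n (x∉xs ∷ u) ((d , sec , _) ∷ ps) .Counted.counted e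
  with d ≟ e | Counted-tally m≤n u ps .Counted.counted e
... | yes refl | (ys , v , l , p , q) =
  _ ∷ ys ,
  All.tabulate (λ y∈ys → All.lookup x∉xs (proj₁ (q y∈ys))) ∷ v ,
  cong suc l ,
  (λ { (here refl , _) → here refl ; (there s∈xs , sec′) → there (p (s∈xs , sec′)) }) ,
  λ { (here refl) → here refl , sec ; (there s∈ys) → there (proj₁ (q s∈ys)) , proj₂ (q s∈ys) }
... | no d≢e | ys = size-cong
  ( (λ (s∈xs , sec′) → there s∈xs , sec′)
  , λ { (here refl , sec′) → ⊥-elim (d≢e (section-unique m≤n d e sec sec′))
      ; (there s∈xs , sec′) → s∈xs , sec′ }) ys

fromBool : Bool → ℕ
fromBool b = if b then 1 else 0

sides-bump : ∀ d ν → sides (bump d ν) ≡ fromBool (isSide d) + sides ν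
sides-bump E ν = refl
sides-bump N ν = cong (λ k → k + ν W + ν S) (ℕ.+-suc (ν E) (ν N))
sides-bump W ν = cong (_+ ν S) (ℕ.+-suc (ν E + ν N) (ν W))
sides-bump S ν = ℕ.+-suc (ν E + ν N + ν W) (ν S)
sides-bump NE ν = refl
sides-bump NW ν = refl
sides-bump SW ν = refl
sides-bump SE ν = refl

corners-bump : ∀ d ν → corners (bump d ν) ≡ fromBool (not (isSide d)) + corners ν
corners-bump E ν = refl
corners-bump N ν = refl
corners-bump W ν = refl
corners-bump S ν = refl
corners-bump NE ν = refl
corners-bump NW ν = cong (λ k → k + ν SW + ν SE) (ℕ.+-suc (ν NE) (ν NW))
corners-bump SW ν = cong (_+ ν SE) (ℕ.+-suc (ν NE + ν NW) (ν SW))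
corners-bump SE ν = ℕ.+-suc (ν NE + ν NW + ν SW) (ν SE)

-- As many side squares as corner squares, namely k of each.
record Balanced (k : ℕ) (ν : Counts) : Set where
  constructor balanced
  field
    sides≡   : sides ν ≡ k
    corners≡ : corners ν ≡ k

-- Two squares joined by a move contribute one side and one corner.
bump-pair : ∀ d e {k ν} → isSide e ≡ not (isSide d) →
  Balanced k ν → Balanced (suc k) (bump d (bump e ν))
bump-pair d e {ν = ν} alt (balanced p q) =
  balanced (trans sides-eq (cong suc p)) (trans corners-eq (cong suc q))
  where
  sides-eq : sides (bump d (bump e ν)) ≡ suc (sides ν)
  sides-eq rewrite sides-bump d (bump e ν) | sides-bump e ν | alt with isSide d
  ... | true  = refl
  ... | false = refl
  corners-eq : corners (bump d (bump e ν)) ≡ suc (corners ν)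
  corners-eq rewrite corners-bump d (bump e ν) | corners-bump e ν | alt with isSide d
  ... | true  = refl
  ... | false = refl

-- The eight squares form four consecutive pairs, to which bump-pair applies.
shellCycle-counted : ∀ {m n C} → IsShellCycle m n C →
  m ≤ n × ∃[ ν ] Counted m n (_∈ C) ν × Balanced 4 ν
shellCycle-counted {m} {n} {C@(_ ∷ _ ∷ _ ∷ _ ∷ _ ∷ _ ∷ _ ∷ _ ∷ [])} (cyc , refl)
  with IsCycle.within cyc | IsCycle.closed cyc
... | w@(w₁ ∷ w₂ ∷ w₃ ∷ w₄ ∷ w₅ ∷ w₆ ∷ w₇ ∷ w₈ ∷ []) | m₁ ∷ _ ∷ m₃ ∷ _ ∷ m₅ ∷ _ ∷ m₇ ∷ _ =
  m≤n , tally placed , Counted-tally m≤n (IsCycle.simple cyc) placed ,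
  pair w₁ w₂ m₁ (pair w₃ w₄ m₃ (pair w₅ w₆ m₅ (pair w₇ w₈ m₇ (balanced {ν = λ _ → 0} refl refl))))
  where
  m≤n : m ≤ n
  m≤n = Shell⇒≤ w₁
  placed : All (λ s → ∃[ d ] Placed m n d s) C
  placed = All.map Shell-placed w
  pair : ∀ {s t k ν} (p : Shell m n s) (q : Shell m n t) → Move m n s t →
    Balanced k ν → Balanced (suc k) (bump (proj₁ (Shell-placed p)) (bump (proj₁ (Shell-placed q)) ν))
  pair p q move =
    let (d , _ , zone)  = Shell-placed p
        (e , _ , zone′) = Shell-placed q
    in bump-pair d e (Zone-alternates m≤n (isSide d) (isSide e) move zone zone′)

------------------------------------------------------------------------
-- The size of a lifted shell cycle

Counted-liftWord : ∀ w {m n A ν} → m ≤ n → Counted m n A ν →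
  let (m′ , n′) = foldr target (m , n) w in
  m′ ≤ n′ × ∃[ ν′ ] Counted m′ n′ (liftWord w (m , n) A) ν′ ×
  (sides ν′ , corners ν′) ≡ foldr act (sides ν , corners ν) w
Counted-liftWord [] m≤n c = m≤n , _ , c , refl
Counted-liftWord (x ∷ w) {m} {n} m≤n c =
  let (m′≤n′ , ν′ , c′ , eq) = Counted-liftWord w m≤n c
  in target-ordered x m′≤n′ , liftCounts x ν′ , Counted-lift m′≤n′ x c′ ,
     trans (cong₂ _,_ (act-sides x ν′) (act-corners x ν′)) (cong (act x) eq)

sum-directions : ∀ ν → sum (map ν directions) ≡ sides ν + corners ν
sum-directions ν = eq (ν E) (ν NE) (ν N) (ν NW) (ν W) (ν SW) (ν S) (ν SE)
  where
  eq : ∀ e ne n nw w sw s se →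
    e + (ne + (n + (nw + (w + (sw + (s + (se + 0))))))) ≡ (e + n + w + s) + (ne + nw + sw + se)
  eq = ℕ-solve-∀

-- The pair that a word makes of (1 , 1): a quarter of the counts of a shell cycle
-- lifted by this word.
weights : List Lifting → ℕ × ℕ
weights = foldr act (1 , 1)

scale : ℕ → ℕ × ℕ → ℕ × ℕ
scale k (s , c) = k * s , k * c

act-scale : ∀ k x sc → act x (scale k sc) ≡ scale k (act x sc)
act-scale k 𝕗 (s , c) = cong (_, k * c) (eq k s c)
  where
  eq : ∀ k s c → k * s + 2 * (k * c) ≡ k * (s + 2 * c)
  eq = ℕ-solve-∀
act-scale k 𝕘 (s , c) = cong (k * s ,_) (eq k s c)
  where
  eq : ∀ k s c → k * c + 2 * (k * s) ≡ k * (c + 2 * s)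
  eq = ℕ-solve-∀
act-scale k 𝕙 (s , c) = cong₂ _,_ (eq₁ k s c) (eq₂ k s c)
  where
  eq₁ : ∀ k s c → 3 * (k * s) + 2 * (k * c) ≡ k * (3 * s + 2 * c)
  eq₁ = ℕ-solve-∀
  eq₂ : ∀ k s c → k * c + 2 * (k * s) ≡ k * (c + 2 * s)
  eq₂ = ℕ-solve-∀

weights-scale : ∀ k w → foldr act (k , k) w ≡ scale k (weights w)
weights-scale k [] = cong₂ _,_ (sym (ℕ.*-identityʳ k)) (sym (ℕ.*-identityʳ k))
weights-scale k (x ∷ w) = trans (cong (act x) (weights-scale k w)) (act-scale k x (weights w))

∣m+n∣n⇒∣m : ∀ {k} m {n} → k ∣ m + n → k ∣ n → k ∣ m
∣m+n∣n⇒∣m {k} m {n} k∣m+n k∣n = ∣m+n∣m⇒∣n (subst (k ∣_) (ℕ.+-comm m n) k∣m+n) k∣n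

act-coprime : ∀ x {s c} → Coprime s c → Coprime (proj₁ (act x (s , c))) (proj₂ (act x (s , c)))
act-coprime 𝕗 {s} {c} cop (k∣s+2c , k∣c) = cop (∣m+n∣n⇒∣m _ k∣s+2c (∣n⇒∣m*n 2 k∣c) , k∣c)
act-coprime 𝕘 {s} {c} cop (k∣s , k∣c+2s) = cop (k∣s , ∣m+n∣n⇒∣m _ k∣c+2s (∣n⇒∣m*n 2 k∣s))
act-coprime 𝕙 {s} {c} cop {k} (p , q) = cop (k∣s , ∣m+n∣m⇒∣n k∣s+c k∣s)
  where
  eq₁ : ∀ s c → 3 * s + 2 * c ≡ (c + 2 * s) + (s + c)
  eq₁ = ℕ-solve-∀
  eq₂ : ∀ s c → c + 2 * s ≡ (s + c) + s
  eq₂ = ℕ-solve-∀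
  k∣s+c : k ∣ s + c
  k∣s+c = ∣m+n∣m⇒∣n (subst (k ∣_) (eq₁ s c) p) q
  k∣s : k ∣ s
  k∣s = ∣m+n∣m⇒∣n (subst (k ∣_) (eq₂ s c) q) k∣s+c

weights-coprime : ∀ w → Coprime (proj₁ (weights w)) (proj₂ (weights w))
weights-coprime [] = Coprimality.1-coprimeTo 1
weights-coprime (x ∷ w) = act-coprime x (weights-coprime w)

weights-sum-coprime : ∀ w → let (s , c) = weights w in Coprime (s + c) c
weights-sum-coprime w (k∣s+c , k∣c) = weights-coprime w (∣m+n∣n⇒∣m _ k∣s+c k∣c , k∣c)

weights-𝕗s : ∀ a w → let (s , c) = weights w in weights (replicate a 𝕗 ++ w) ≡ (s + 2 * a * c , c)
weights-𝕗s zero w = let (s , c) = weights w in cong (_, c) (sym (ℕ.+-identityʳ s))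
weights-𝕗s (suc a) w = let (s , c) = weights w in
  trans (cong (act 𝕗) (weights-𝕗s a w)) (cong (_, c) (eq a s c))
  where
  eq : ∀ a s c → s + 2 * a * c + 2 * c ≡ s + 2 * suc a * c
  eq = ℕ-solve-∀

------------------------------------------------------------------------
-- Rationals as quotients of integers

-- The embedding of the integers.
ι : ℤ → ℚ
ι i = i ℚ./ 1

toℚᵘ-/ : ∀ i n .{{_ : ℕ.NonZero n}} → toℚᵘ (i ℚ./ n) ℚᵘ.≃ i ℚᵘ./ n
toℚᵘ-/ i (suc n) = ℚ.toℚᵘ-fromℚᵘ (mkℚᵘ i n)

ι-* : ∀ i j → ι i ℚ.* ι j ≡ ι (i ℤ.* j)
ι-* i j = ℚ.toℚᵘ-injective (begin
  toℚᵘ (ι i ℚ.* ι j)          ≈⟨ ℚ.toℚᵘ-homo-* (ι i) (ι j) ⟩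
  toℚᵘ (ι i) ℚᵘ.* toℚᵘ (ι j)  ≈⟨ ℚᵘ.*-cong (toℚᵘ-/ i 1) (toℚᵘ-/ j 1) ⟩
  i ℚᵘ./ 1 ℚᵘ.* (j ℚᵘ./ 1)    ≈⟨ ℚᵘ.≃-refl ⟩
  (i ℤ.* j) ℚᵘ./ 1            ≈⟨ toℚᵘ-/ (i ℤ.* j) 1 ⟨
  toℚᵘ (ι (i ℤ.* j))          ∎)
  where open ℚᵘ.≃-Reasoning

ι-+ : ∀ i j → ι i ℚ.+ ι j ≡ ι (i ℤ.+ j)
ι-+ i j = ℚ.toℚᵘ-injective (begin
  toℚᵘ (ι i ℚ.+ ι j)          ≈⟨ ℚ.toℚᵘ-homo-+ (ι i) (ι j) ⟩
  toℚᵘ (ι i) ℚᵘ.+ toℚᵘ (ι j)  ≈⟨ ℚᵘ.+-cong (toℚᵘ-/ i 1) (toℚᵘ-/ j 1) ⟩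
  i ℚᵘ./ 1 ℚᵘ.+ (j ℚᵘ./ 1)    ≈⟨ *≡* (cong (ℤ._* + 1) (cong₂ ℤ._+_ (ℤ.*-identityʳ i) (ℤ.*-identityʳ j))) ⟩
  (i ℤ.+ j) ℚᵘ./ 1            ≈⟨ toℚᵘ-/ (i ℤ.+ j) 1 ⟨
  toℚᵘ (ι (i ℤ.+ j))          ∎)
  where open ℚᵘ.≃-Reasoning

ι-neg : ∀ i → ℚ.- ι i ≡ ι (- i)
ι-neg i = ℚ.toℚᵘ-injective (begin
  toℚᵘ (ℚ.- ι i)              ≈⟨ ℚ.toℚᵘ-homo‿- (ι i) ⟩
  ℚᵘ.- toℚᵘ (ι i)             ≈⟨ ℚᵘ.-‿cong (toℚᵘ-/ i 1) ⟩
  (- i) ℚᵘ./ 1                ≈⟨ toℚᵘ-/ (- i) 1 ⟨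
  toℚᵘ (ι (- i))              ∎)
  where open ℚᵘ.≃-Reasoning

ι-injective : ∀ {i j} → ι i ≡ ι j → i ≡ j
ι-injective {i} {j} eq with ℚ.fromℚᵘ-injective {mkℚᵘ i 0} {mkℚᵘ j 0} eq
... | *≡* e = trans (sym (ℤ.*-identityʳ i)) (trans e (ℤ.*-identityʳ j))

infix 4 _represents_∶_

-- v is the quotient a/b, stated without division; for b = 0 it only says a = 0.
record _represents_∶_ (v : ℚ) (a b : ℤ) : Set where
  constructor representation
  field
    product≡ : v ℚ.* ι b ≡ ι a

represents-cong : ∀ {v a a′ b} → a ≡ a′ → v represents a ∶ b → v represents a′ ∶ b
represents-cong refl r = r

/-represents : ∀ a b .{{_ : ℕ.NonZero b}} → (a ℚ./ b) represents a ∶ + b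
/-represents a b@(suc _) = representation (ℚ.toℚᵘ-injective (begin
  toℚᵘ (a ℚ./ b ℚ.* ι (+ b))            ≈⟨ ℚ.toℚᵘ-homo-* (a ℚ./ b) (ι (+ b)) ⟩
  toℚᵘ (a ℚ./ b) ℚᵘ.* toℚᵘ (ι (+ b))    ≈⟨ ℚᵘ.*-cong (toℚᵘ-/ a b) (toℚᵘ-/ (+ b) 1) ⟩
  a ℚᵘ./ b ℚᵘ.* (+ b ℚᵘ./ 1)            ≈⟨ *≡* (eq a (+ b)) ⟩
  a ℚᵘ./ 1                              ≈⟨ toℚᵘ-/ a 1 ⟨
  toℚᵘ (ι a)                            ∎))
  where
  open ℚᵘ.≃-Reasoning
  eq : ∀ a b → a ℤ.* b ℤ.* + 1 ≡ a ℤ.* (b ℤ.* + 1)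
  eq = ℤ-solve-∀

ι-represents : ∀ a → ι a represents a ∶ + 1
ι-represents a = representation (trans (ι-* a (+ 1)) (cong ι (ℤ.*-identityʳ a)))

represents-unique : ∀ {v a b c d} → v represents a ∶ b → v represents c ∶ d → a ℤ.* d ≡ c ℤ.* b
represents-unique {v} {a} {b} {c} {d} (representation p) (representation q) = ι-injective (begin
  ι (a ℤ.* d)            ≡⟨ ι-* a d ⟨
  ι a ℚ.* ι d            ≡⟨ cong (ℚ._* ι d) p ⟨
  v ℚ.* ι b ℚ.* ι d      ≡⟨ ℚ.*-assoc v (ι b) (ι d) ⟩
  v ℚ.* (ι b ℚ.* ι d)    ≡⟨ cong (v ℚ.*_) (ℚ.*-comm (ι b) (ι d)) ⟩
  v ℚ.* (ι d ℚ.* ι b)    ≡⟨ ℚ.*-assoc v (ι d) (ι b) ⟨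
  v ℚ.* ι d ℚ.* ι b      ≡⟨ cong (ℚ._* ι b) q ⟩
  ι c ℚ.* ι b            ≡⟨ ι-* c b ⟩
  ι (c ℤ.* b)            ∎)
  where open ≡-Reasoning

1/-represents : ∀ {v a b} .{{_ : ℚ.NonZero v}} → v represents a ∶ b → (1/ v) represents b ∶ a
1/-represents {v} {a} {b} (representation p) = representation (begin
  1/ v ℚ.* ι a            ≡⟨ cong (1/ v ℚ.*_) p ⟨
  1/ v ℚ.* (v ℚ.* ι b)    ≡⟨ ℚ.*-assoc (1/ v) v (ι b) ⟨
  1/ v ℚ.* v ℚ.* ι b      ≡⟨ cong (ℚ._* ι b) (ℚ.*-inverseˡ v) ⟩
  ℚ.1ℚ ℚ.* ι b            ≡⟨ ℚ.*-identityˡ (ι b) ⟩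
  ι b                     ∎)
  where open ≡-Reasoning

infixl 6 _⟪_⟫_

-- The sum or difference chosen by the sign, as in signedSum.
_⟪_⟫_ : ℤ → Sign → ℤ → ℤ
a ⟪ Sign.+ ⟫ b = a ℤ.+ b
a ⟪ Sign.- ⟫ b = a ℤ.- b

signedSum-represents : ∀ c σ {u a b} → u represents b ∶ a →
  signedSum (ι c) σ u represents ((c ℤ.* a) ⟪ σ ⟫ b) ∶ a
signedSum-represents c Sign.+ {u} {a} {b} (representation p) = representation (begin
  (ι c ℚ.+ u) ℚ.* ι a          ≡⟨ ℚ.*-distribʳ-+ (ι a) (ι c) u ⟩
  ι c ℚ.* ι a ℚ.+ u ℚ.* ι a    ≡⟨ cong₂ ℚ._+_ (ι-* c a) p ⟩
  ι (c ℤ.* a) ℚ.+ ι b          ≡⟨ ι-+ (c ℤ.* a) b ⟩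
  ι (c ℤ.* a ℤ.+ b)            ∎)
  where open ≡-Reasoning
signedSum-represents c Sign.- {u} {a} {b} (representation p) = signedSum-represents c Sign.+ (representation
  (trans (sym (ℚ.neg-distribˡ-* u (ι a))) (trans (cong ℚ.-_ p) (ι-neg b))))

step-represents : ∀ c σ {v a b} .{{_ : ℚ.NonZero v}} → v represents a ∶ b →
  signedSum (ι c) σ (1/ v) represents ((c ℤ.* a) ⟪ σ ⟫ b) ∶ a
step-represents c σ p = signedSum-represents c σ (1/-represents p)

------------------------------------------------------------------------
-- The value of the interleaved continued fraction

+-cancel : ∀ {x y z} → x ≡ y + z → + x ℤ.- + z ≡ + y
+-cancel {y = y} {z} refl = eq (+ y) (+ z)
  where
  eq : ∀ a b → a ℤ.+ b ℤ.- b ≡ a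
  eq = ℤ-solve-∀

-- All terms, the first included, are even and positive.
Positive : ContinuedFraction → Set
Positive t = All (2 ∣_) (terms t) × All (0 <_) (terms t)

-- An even positive term c is 2 + 2a, and a is the length of its run of 𝕗.
even-positive : ∀ {c} → 2 ∣ c → 0 < c → ∃[ a ] c ≡ 2 + 2 * a × c / 2 ∸ 1 ≡ a
even-positive (divides (suc a) refl) _ = a , cong (λ b → 2 + b) (ℕ.*-comm a 2) , cong (_∸ 1) (m*n/n≡m (suc a) 2)
even-positive (divides zero refl) ()

-- The value of a continued fraction with positive even terms is at least 1.
atLeast1 : ∀ t {v} → Positive t → Value t v →
  ∃[ a ] ∃[ b ] 0 < b × b ≤ a × v represents + a ∶ + b
atLeast1 [ c ] (_ , 0<c ∷ []) [ _ ] = c , 1 , s≤s z≤n , 0<c , ι-represents (+ c)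
atLeast1 (c ⟨ σ ⟩ t) (2∣c ∷ ev , 0<c ∷ pos) (_⟨_⟩_ c σ {v = v} val)
  with even-positive 2∣c 0<c | atLeast1 t (ev , pos) val
... | h , refl , _ | a , b , 0<b , b≤a , rep = go σ
  where
  rep′ : ∀ σ → signedSum (ι (+ c)) σ (1/ v) represents ((+ c ℤ.* + a) ⟪ σ ⟫ + b) ∶ + a
  rep′ σ = step-represents (+ c) σ rep
  a+b≤ca : a + b ≤ c * a
  a+b≤ca = ℕ.+-monoʳ-≤ a (ℕ.≤-trans b≤a (ℕ.m≤m+n a _))
  go : ∀ σ → ∃[ a′ ] ∃[ b′ ] 0 < b′ × b′ ≤ a′ × signedSum (ι (+ c)) σ (1/ v) represents + a′ ∶ + b′
  go Sign.+ = c * a + b , a , ℕ.<-≤-trans 0<b b≤a ,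
    ℕ.≤-trans (ℕ.m+n≤o⇒m≤o a a+b≤ca) (ℕ.m≤m+n _ b) ,
    represents-cong (cong (ℤ._+ + b) (sym (ℤ.pos-* c a))) (rep′ Sign.+)
  go Sign.- = c * a ∸ b , a , ℕ.<-≤-trans 0<b b≤a ,
    ℕ.m+n≤o⇒m≤o∸n a a+b≤ca ,
    represents-cong (trans (cong (ℤ._- + b) (sym (ℤ.pos-* c a)))
      (+-cancel (sym (ℕ.m∸n+n≡m (ℕ.m+n≤o⇒n≤o a a+b≤ca))))) (rep′ Sign.-)

-- If the first term is 0, then the value is ±1/v with v ≥ 1, so it is at most 1.
firstTerm-positive : ∀ t {p q v} → IsEven t → Value t v → v represents + q ∶ + p → p < q →
  All (0 <_) (terms t)
firstTerm-positive [ suc c ] _ _ _ _ = s≤s z≤n ∷ []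
firstTerm-positive [ zero ] {p} {q} _ [ _ ] rep p<q =
  ⊥-elim (ℕ.n≮0 (subst (p <_) (trans (sym (ℕ.*-identityʳ q)) q≡0) p<q))
  where
  q≡0 : q * 1 ≡ 0 * p
  q≡0 = ℤ.+-injective (trans (ℤ.pos-* q 1)
    (trans (represents-unique rep (ι-represents (+ 0))) (ℤ.*-zeroˡ (+ p))))
firstTerm-positive (suc c ⟨ σ ⟩ t) (_ , pos) _ _ _ = s≤s z≤n ∷ pos
firstTerm-positive (zero ⟨ σ ⟩ t) {p} {q} (_ ∷ ev , pos) (_⟨_⟩_ 0 σ {v = v} val) rep p<q
  with atLeast1 t (ev , pos) val
... | a , b , 0<b , b≤a , rep′ = ⊥-elim (go σ rep)
  where
  0<a : 0 < a
  0<a = ℕ.<-≤-trans 0<b b≤a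
  instance _ = ℕ.>-nonZero 0<a
  cross : ∀ σ → signedSum (ι (+ 0)) σ (1/ v) represents + q ∶ + p →
    + (q * a) ≡ ((+ 0 ℤ.* + a) ⟪ σ ⟫ + b) ℤ.* + p
  cross σ rep = trans (ℤ.pos-* q a) (represents-unique rep (step-represents (+ 0) σ rep′))
  go : ∀ σ → ¬ signedSum (ι (+ 0)) σ (1/ v) represents + q ∶ + p
  go Sign.+ rep = ℕ.<⇒≱ (ℕ.*-monoˡ-< a p<q) (subst₂ _≤_ (sym eq) (ℕ.*-comm a p) (ℕ.*-monoˡ-≤ p b≤a))
    where
    eq : q * a ≡ b * p
    eq = ℤ.+-injective (trans (cross Sign.+ rep) (sym (ℤ.pos-* b p)))
  go Sign.- rep = ℕ.<⇒≱ (ℕ.*-monoˡ-< a p<q) (ℕ.≤-trans (ℕ.≤-reflexive qa≡0) z≤n)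
    where
    sum≡0 : + (q * a + b * p) ≡ + 0
    sum≡0 = trans (cong₂ ℤ._+_ (cross Sign.- rep) (ℤ.pos-* b p)) (eq (+ b) (+ p))
      where
      eq : ∀ b p → (+ 0 ℤ.- b) ℤ.* p ℤ.+ b ℤ.* p ≡ + 0
      eq = ℤ-solve-∀
    qa≡0 : q * a ≡ 0
    qa≡0 = ℕ.m+n≡0⇒m≡0 (q * a) (ℤ.+-injective sum≡0)

-- The run of 𝕗 that belongs to the term c maps (s , k) to (s + (c - 2)k , k).
weights-block : ∀ {c} w → 2 ∣ c → 0 < c → let (s , k) = weights w in
  ∃[ s′ ] weights (replicate (c / 2 ∸ 1) 𝕗 ++ w) ≡ (s′ , k) × s′ + 2 * k ≡ s + c * k
weights-block w 2∣c 0<c with even-positive 2∣c 0<c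
... | a , refl , h rewrite h = _ , weights-𝕗s a w , eq a (proj₁ (weights w)) (proj₂ (weights w))
  where
  eq : ∀ a s k → s + 2 * a * k + 2 * k ≡ s + (2 + 2 * a) * k
  eq = ℕ-solve-∀

-- The value that corresponds to a pair (s , c).
Ratio : ℚ → ℕ × ℕ → Set
Ratio v (s , c) = v represents + (s + c) ∶ + c

-- One step of the interleaved fraction, c ± 1/(2 - 1/v′), corresponds to 𝕘 or 𝕙
-- followed by the run of 𝕗 of the term c.
step-Ratio : ∀ {c s₀ c₀} σ {v′ u} s′ .{{_ : ℚ.NonZero v′}} .{{_ : ℚ.NonZero u}} →
  let (s , k) = act (liftingOf σ) (s₀ , c₀) in
  s′ + 2 * k ≡ s + c * k → Ratio v′ (s₀ , c₀) → u ≡ ι (+ 2) ℚ.- 1/ v′ →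
  Ratio (signedSum (ι (+ c)) σ (1/ u)) (s′ , k)
step-Ratio {c} {s₀} {c₀} σ {v′} {u} s′ eq rep refl = go σ eq
  where
  k = c₀ + 2 * s₀
  rep-u : u represents + k ∶ + (s₀ + c₀)
  rep-u = represents-cong
    (trans (cong (ℤ._- + c₀) (sym (ℤ.pos-* 2 (s₀ + c₀)))) (+-cancel (e s₀ c₀)))
    (step-represents (+ 2) Sign.- rep)
    where
    e : ∀ s c → 2 * (s + c) ≡ c + 2 * s + c
    e = ℕ-solve-∀
  rep-v : ∀ σ → signedSum (ι (+ c)) σ (1/ u) represents ((+ c ℤ.* + k) ⟪ σ ⟫ + (s₀ + c₀)) ∶ + k
  rep-v σ = step-represents (+ c) σ rep-u
  go : ∀ σ → s′ + 2 * proj₂ (act (liftingOf σ) (s₀ , c₀)) ≡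
    proj₁ (act (liftingOf σ) (s₀ , c₀)) + c * proj₂ (act (liftingOf σ) (s₀ , c₀)) →
    Ratio (signedSum (ι (+ c)) σ (1/ u)) (s′ , proj₂ (act (liftingOf σ) (s₀ , c₀)))
  go Sign.+ eq = represents-cong
    (trans (cong (ℤ._+ + (s₀ + c₀)) (sym (ℤ.pos-* c k)))
      (cong (λ x → + x) (ℕ.+-cancelʳ-≡ k _ _ (trans (e₁ (c * k) s₀ c₀) (trans (sym eq) (e₂ s′ k))))))
    (rep-v Sign.+)
    where
    e₁ : ∀ x s c → x + (s + c) + (c + 2 * s) ≡ 3 * s + 2 * c + x
    e₁ = ℕ-solve-∀
    e₂ : ∀ s k → s + 2 * k ≡ s + k + k
    e₂ = ℕ-solve-∀
  go Sign.- eq = represents-cong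
    (trans (cong (ℤ._- + (s₀ + c₀)) (sym (ℤ.pos-* c k)))
      (+-cancel (ℕ.+-cancelˡ-≡ s₀ _ _ (trans (sym eq) (e s′ s₀ c₀)))))
    (rep-v Sign.-)
    where
    e : ∀ s′ s c → s′ + 2 * (c + 2 * s) ≡ s + (s′ + (c + 2 * s) + (s + c))
    e = ℕ-solve-∀

base-Ratio : ∀ {c} → 2 ∣ c → 0 < c → Ratio (ι (+ c)) (weights (replicate (c / 2 ∸ 1) 𝕗))
base-Ratio {c} 2∣c 0<c with weights-block [] 2∣c 0<c
... | s′ , h , eq = subst (Ratio (ι (+ c))) (trans (sym h) (cong weights (List.++-identityʳ (replicate (c / 2 ∸ 1) 𝕗))))
  (subst (λ l → ι (+ c) represents + l ∶ + 1) c≡s′+1 (ι-represents (+ c)))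
  where
  c≡s′+1 : c ≡ s′ + 1
  c≡s′+1 = ℕ.suc-injective (trans (cong suc (sym (ℕ.*-identityʳ c))) (trans (sym eq) (ℕ.+-suc s′ 1)))

interleave2-Ratio : ∀ t i {v} → Positive t → Value (interleave2 t i) v → Ratio v (weights (typeWord t i))
interleave2-Ratio [ c ] zero (2∣c ∷ _ , 0<c ∷ _) [ c ] = base-Ratio 2∣c 0<c
interleave2-Ratio (c ⟨ σ ⟩ t) zero (2∣c ∷ _ , 0<c ∷ _) [ c ] = base-Ratio 2∣c 0<c
interleave2-Ratio (c ⟨ σ ⟩ t) (suc i) (2∣c ∷ ev , 0<c ∷ pos)
  (_⟨_⟩_ c σ (_⟨_⟩_ 2 _ {v = v′} val))
  with weights-block (liftingOf σ ∷ typeWord t i) 2∣c 0<c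
... | s′ , h , eq = subst (Ratio _) (sym h)
  (step-Ratio {c} σ s′ eq (interleave2-Ratio t i (ev , pos) val) refl)

coprime-ratio-unique : ∀ {l d l′ d′} → Coprime l d → Coprime l′ d′ → l * d′ ≡ l′ * d → l ≡ l′
coprime-ratio-unique {l} {d} {l′} {d′} cop cop′ eq = ∣-antisym
  (coprime-divisor cop (divides d′ (trans (ℕ.*-comm d l′) (trans (sym eq) (ℕ.*-comm l d′)))))
  (coprime-divisor cop′ (divides d (trans (ℕ.*-comm d′ l) (trans eq (ℕ.*-comm l′ d)))))

theorem5 : (p q : ℕ) → IsBasic p q → IsSkew p q → p < q →
    (t : ContinuedFraction) → IsEven t → t hasValue q / p →
    (i : Fin (length (terms t))) →
    (l d : ℕ) → Coprime l d → interleave2 t i hasValue l / d →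
    (C : List Square) → IsCycle p q (Board (p + q)) C → OfType t i C →
    length C ≡ 4 * l
theorem5 p q _ _ p<q t even@(ev , _) (p≢0 , val) i l d cop (d≢0 , val′) C cyc (m , n , C₀ , _ , shell , C≐) =
  let (m≤n , ν₀ , counted₀ , balanced s₀ c₀) = shellCycle-counted shell
      (m′≤n′ , ν , counted , eq) = Counted-liftWord (typeWord t i) m≤n counted₀
      weights≡ : (sides ν , corners ν) ≡ scale 4 (weights (typeWord t i))
      weights≡ = trans eq (trans (cong₂ (λ a b → foldr act (a , b) (typeWord t i)) s₀ c₀) (weights-scale 4 (typeWord t i)))
      (s , c) = weights (typeWord t i)
      positive = firstTerm-positive t even val (/-represents (+ q) p {{p≢0}}) p<q
      ratio = interleave2-Ratio t i (ev , positive) val′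
      lc≡ : l * c ≡ (s + c) * d
      lc≡ = ℤ.+-injective (trans (ℤ.pos-* l c) (trans
        (represents-unique (/-represents (+ l) d {{d≢0}}) ratio) (sym (ℤ.pos-* (s + c) d))))
      l≡ : l ≡ s + c
      l≡ = coprime-ratio-unique cop (weights-sum-coprime (typeWord t i)) lc≡
  in begin
    length C                  ≡⟨ size-unique (total m′≤n′ counted) (IsCycle.simple cyc) C≐ ⟩
    sum (map ν directions)    ≡⟨ sum-directions ν ⟩
    sides ν + corners ν       ≡⟨ cong₂ _+_ (cong proj₁ weights≡) (cong proj₂ weights≡) ⟩
    4 * s + 4 * c             ≡⟨ ℕ.*-distribˡ-+ 4 s c ⟨
    4 * (s + c)               ≡⟨ cong (4 *_) l≡ ⟨
    4 * l                     ∎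
  where open ≡-Reasoning
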